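{- Let $d \geq 1$, let $k, \ell \geq 0$ be integers with $k+\ell \leq d-1$, and let $a \geq 1$ be an integer. Consider the finite sequence $$(\delta_0,\ldots,\delta_d)=(1, \underbrace{0,\ldots,0}_{k},a,\ldots,a,\underbrace{0,\ldots,0}_{\ell})$$ of length $d+1$ (so that $\delta_0=1$, $\delta_i=0$ for $1\le i\le k$, $\delta_i=a$ for $k+1\le i\le d-\ell$, and $\delta_i=0$ for $d-\ell+1\le i\le d$). Then there exists an integral convex polytope $\mathcal{P} \subset \mathbb{R}^d$ of dimension $d$ whose $\delta$-vector coincides with $(\delta_0,\ldots,\delta_d)$ if and only if $k \leq \ell$.
   Context: An integral convex polytope is a convex polytope all of whose vertices have integer coordinates. For an integral convex polytope $\mathcal{P}\subset\mathbb{R}^d$ of dimension $d$, let $i(\mathcal{P},n)=|n\mathcal{P}\cap\mathbb{Z}^d|$ for integers $n\ge 0$ (this is a polynomial in $n$ of degree $d$, the Ehrhart polynomial). The $\delta$-vector $\delta(\mathcal{P})=(\delta_0,\ldots,\delta_d)$ is defined by $(1-\lambda)^{d+1}\sum_{n=0}^{\infty} i(\mathcal{P},n)\lambda^n=\sum_{j=0}^{d}\delta_j\lambda^j$. -}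

module Defs where

open import Data.Nat as ℕ using (ℕ; zero; suc; _≤ᵇ_; _∸_)
open import Data.Nat.Combinatorics using (_C_)
open import Data.Integer as ℤ using (ℤ; +_; -_; _+_; _*_; _-_)
open import Data.Fin using (Fin)
open import Data.Vec using (Vec; []; _∷_; replicate; zipWith; map; lookup; sum)
open import Data.List using (List; length)
open import Data.List.Relation.Unary.Unique.Propositional using (Unique)
open import Data.List.Membership.Propositional using (_∈_)
open import Data.Product using (Σ; _×_)
open import Data.Bool using (if_then_else_)
open import Function.Bundles using (_⇔_)
open import Relation.Binary.PropositionalEquality using (_≡_)

lincomb : ∀ {d m} → Vec ℕ m → Vec (Vec ℤ d) m → Vec ℤ d
lincomb [] [] = replicate _ (+ 0)
lincomb (c ∷ cs) (v ∷ vs) = zipWith _+_ (map (λ z → + c * z) v) (lincomb cs vs)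

lincombℤ : ∀ {d m} → Vec ℤ m → Vec (Vec ℤ d) m → Vec ℤ d
lincombℤ [] [] = replicate _ (+ 0)
lincombℤ (c ∷ cs) (v ∷ vs) = zipWith _+_ (map (λ z → c * z) v) (lincombℤ cs vs)

-- x ∈ n · conv(V) : x = Σ λ_i V_i with λ_i ≥ 0 rational, Σ λ_i = n;
-- clearing denominators: N x = Σ c_i V_i with N > 0, c_i ∈ ℕ, Σ c_i = N n.
InDilate : ∀ {d m} → Vec (Vec ℤ d) m → ℕ → Vec ℤ d → Set
InDilate {d} {m} V n x =
  Σ ℕ λ N → (0 ℕ.< N) × Σ (Vec ℕ m) λ c →
    (sum c ≡ N ℕ.* n) × (map (λ z → + N * z) x ≡ lincomb c V)

LatticeCount : ∀ {d m} → Vec (Vec ℤ d) m → ℕ → ℕ → Set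
LatticeCount {d} V n c =
  Σ (List (Vec ℤ d)) λ L → Unique L × (∀ x → (x ∈ L) ⇔ InDilate V n x) × (length L ≡ c)

-- conv(V) has dimension d: some V_p and V_{w_1},…,V_{w_d} with
-- V_{w_j} − V_p linearly independent (over ℤ, equivalently over ℚ / ℝ).
FullDim : ∀ {d m} → Vec (Vec ℤ d) m → Set
FullDim {d} {m} V =
  Σ (Fin m) λ p → Σ (Vec (Fin m) d) λ w →
    ∀ (c : Vec ℤ d) →
      lincombℤ c (map (λ j → zipWith _-_ (lookup V j) (lookup V p)) w) ≡ replicate d (+ 0) →
      c ≡ replicate d (+ 0)

sign : ℕ → ℤ
sign zero = + 1
sign (suc t) = - sign t

sumTo : (ℕ → ℤ) → ℕ → ℤ
sumTo f zero = f 0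
sumTo f (suc T) = sumTo f T + f (suc T)

-- coefficient of λ^j in (1-λ)^{d+1} Σ_n i(n) λ^n
deltaCoeff : ℕ → (ℕ → ℕ) → ℕ → ℤ
deltaCoeff d i j = sumTo (λ t → sign t * (+ (suc d C t) * + i (j ∸ t))) j

-- There is an integral convex polytope P ⊂ ℝ^d of dimension d with δ(P) = δ
-- (δ given as a function ℕ → ℤ, δ_j for j ≤ d, and required 0 beyond d).
Realizable : ℕ → (ℕ → ℤ) → Set
Realizable d δ =
  Σ ℕ λ m → Σ (Vec (Vec ℤ d) m) λ V → FullDim V ×
    Σ (ℕ → ℕ) λ i → (∀ n → LatticeCount V n (i n)) ×
      (∀ j → deltaCoeff d i j ≡ δ j)

deltaSeq : ℕ → ℕ → ℕ → ℕ → ℕ → ℤ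
deltaSeq d k l a zero = + 1
deltaSeq d k l a (suc j) =
  if suc j ≤ᵇ k then + 0 else (if suc j ≤ᵇ d ∸ l then + a else + 0)

{-# OPTIONS --safe #-}
-- For a lattice simplex W of dimension d, applying one factor 1 − λ of (1 − λ)^{d+1} per vertex
-- removes from n · W the lattice points having barycentric coordinate ≥ 1 at that vertex.
-- Hence δ_j counts the lattice points x = Σ r_i W_i with Σ r_i = j and all r_i in [0, 1).
--
-- If k ≥ 1, then δ_1 = 0 forces exactly d + 1 lattice points, so the polytope is a simplex.
-- As δ_{d−ℓ} = a > 0, there is such a point x of height d − ℓ.  Replacing each r_i > 0 by 1 − r_i
-- gives another one, of height between 1 and ℓ + 1; as δ_1 = … = δ_k = 0, k < ℓ + 1.
--
-- Conversely, let ℓ = k + e, d = m + k + ℓ and M = 1 + a m.  Take the simplex with vertices 0,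
-- the last d − 1 unit vectors and (M, b), where b consists of m − 1 + k entries −1, k entries 1
-- and e entries 0.  Its nonzero box points are (y, 0, …, 0, 1^k, 0^e) with 0 < y < M.
-- The height of such a point is k + ⌈m y / M⌉ = k + ⌈y / a⌉, so each height in k + 1, …, k + m
-- occurs a times.
module Submission where

open import Defs
open import Data.Nat as ℕ using (ℕ; zero; suc; _+_; _*_; _∸_; _≤_; _<_; z≤n; s≤s; z<s; s<s; _<?_)
import Data.Nat.Properties as ℕₚ
open import Data.Nat.Combinatorics using (_C_; k>n⇒nCk≡0; nCk+nC[k+1]≡[n+1]C[k+1])
open import Data.Integer as ℤ using (ℤ; +_; -[1+_])
import Data.Integer.Properties as ℤₚ
import Data.Nat.Tactic.RingSolver as ℕSolver
import Data.Integer.Tactic.RingSolver as ℤSolver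
open import Data.Fin as Fin using (Fin; zero; suc; toℕ)
import Data.Fin.Properties as Finₚ
open import Data.Vec using (Vec; []; _∷_; replicate; zipWith; map; lookup; sum; tabulate; updateAt; _++_)
import Data.Vec.Properties as Vecₚ
open import Data.List as List using (List; []; _∷_; length)
import Data.List.Properties as Listₚ
open import Data.List.Membership.Propositional using (_∈_)
open import Data.List.Membership.Propositional.Properties
  using (∈-map⁺; ∈-map⁻; ∈-filter⁺; ∈-filter⁻; ∈-++⁺ˡ; ∈-++⁺ʳ; ∈-++⁻; ∈-lookup; ∈-upTo⁺; ∈-upTo⁻)
import Data.List.Membership.Setoid.Properties as Membershipₛ
open import Data.List.Relation.Unary.Any using (here; there; index)
open import Data.List.Relation.Unary.All as All using ([])
open import Data.List.Relation.Unary.AllPairs using ([]; _∷_)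
open import Data.List.Relation.Unary.Unique.Propositional using (Unique)
import Data.List.Relation.Unary.Unique.Propositional.Properties as Uniqueₚ
open import Data.Bool using (true; false)
open import Data.Product using (Σ; ∃; _×_; _,_; proj₁; proj₂)
open import Data.Sum using (_⊎_; inj₁; inj₂; [_,_]′)
open import Data.Empty using (⊥; ⊥-elim)
open import Function using (_∘_)
open import Function.Bundles using (_⇔_; mk⇔; Equivalence)
open import Relation.Nullary using (¬_; Dec; yes; no)
open import Relation.Binary.Definitions using (DecidableEquality)
open import Relation.Binary.PropositionalEquality

open Equivalence using (to; from)

-- Predicates with a given number of solutions

-- `LatticeCount V n` is definitionally `Count (InDilate V n)`.
Count : {A : Set} → (A → Set) → ℕ → Set
Count {A} P c = Σ (List A) λ L → Unique L × (∀ x → (x ∈ L) ⇔ P x) × (length L ≡ c)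

unique-lookup-injective : {A : Set} {xs : List A} → Unique xs → ∀ {i j} →
  List.lookup xs i ≡ List.lookup xs j → i ≡ j
unique-lookup-injective (_ ∷ _) {zero} {zero} _ = refl
unique-lookup-injective (x∉ ∷ _) {zero} {suc j} eq = ⊥-elim (All.lookup x∉ (∈-lookup j) eq)
unique-lookup-injective (x∉ ∷ _) {suc i} {zero} eq = ⊥-elim (All.lookup x∉ (∈-lookup i) (sym eq))
unique-lookup-injective (_ ∷ u) {suc i} {suc j} eq = cong suc (unique-lookup-injective u eq)

-- Sending a position in `xs` to the position of the same element in `ys` is injective, so
-- pigeonhole on `Fin` applies.
unique-⊆⇒length≤ : {A : Set} {xs ys : List A} → Unique xs → (∀ {x} → x ∈ xs → x ∈ ys) →
  length xs ≤ length ys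
unique-⊆⇒length≤ {A} u sub = Finₚ.injective⇒≤ {f = λ i → index (sub (∈-lookup i))}
  (unique-lookup-injective u ∘ Membershipₛ.index-injective (setoid A) _ _)

count-mono : {A : Set} {P Q : A → Set} {m n : ℕ} → (∀ x → P x → Q x) →
  Count P m → Count Q n → m ≤ n
count-mono P⊆Q (_ , u , p , refl) (_ , _ , q , refl) =
  unique-⊆⇒length≤ u (λ {x} → from (q x) ∘ P⊆Q x ∘ to (p x))

count-cong : {A : Set} {P Q : A → Set} {m : ℕ} → (∀ x → P x ⇔ Q x) → Count P m → Count Q m
count-cong e (L , u , p , l) =
  L , u , (λ x → mk⇔ (to (e x) ∘ to (p x)) (from (p x) ∘ from (e x))) , l

count-unique : {A : Set} {P Q : A → Set} {m n : ℕ} → (∀ x → P x ⇔ Q x) →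
  Count P m → Count Q n → m ≡ n
count-unique e p q =
  ℕₚ.≤-antisym (count-mono (λ x → to (e x)) p q) (count-mono (λ x → from (e x)) q p)

count-∅ : {A : Set} {P : A → Set} → (∀ x → ¬ P x) → Count P 0
count-∅ ¬P = [] , [] , (λ x → mk⇔ (λ ()) (λ p → ⊥-elim (¬P x p))) , refl

count-inhabited : {A : Set} {P : A → Set} {m : ℕ} → Count P (suc m) → ∃ P
count-inhabited (x ∷ _ , _ , p , _) = x , to (p x) (here refl)

count-⊎ : {A : Set} {P Q : A → Set} {m n : ℕ} → (∀ x → P x → ¬ Q x) →
  Count P m → Count Q n → Count (λ x → P x ⊎ Q x) (m + n)
count-⊎ disj (L , u , p , refl) (M , v , q , refl) =
  L List.++ M ,
  Uniqueₚ.++⁺ u v (λ {x} (x∈L , x∈M) → disj x (to (p x) x∈L) (to (q x) x∈M)) ,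
  (λ x → mk⇔
    ([ inj₁ ∘ to (p x) , inj₂ ∘ to (q x) ]′ ∘ ∈-++⁻ L)
    [ ∈-++⁺ˡ ∘ from (p x) , ∈-++⁺ʳ L ∘ from (q x) ]′) ,
  Listₚ.length-++ L

count-image : {A B : Set} {P : A → Set} {m : ℕ} (f : A → B) → (∀ {x y} → f x ≡ f y → x ≡ y) →
  Count P m → Count (λ y → Σ A λ x → y ≡ f x × P x) m
count-image f inj (L , u , p , l) =
  List.map f L , Uniqueₚ.map⁺ inj u ,
  (λ y → mk⇔
    (λ y∈ → let (x , x∈ , eq) = ∈-map⁻ f y∈ in x , eq , to (p x) x∈)
    (λ { (x , refl , px) → ∈-map⁺ f (from (p x) px) })) ,
  trans (Listₚ.length-map f L) l

-- The decision may use a proof of `P x`: filtering runs over the list for `P`, and outside that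
-- list `Q` fails because it is contained in `P`.
count-subset : {A : Set} {P Q : A → Set} {m : ℕ} → DecidableEquality A →
  (∀ x → Q x → P x) → (∀ x → P x → Dec (Q x)) → Count P m → ∃ (Count Q)
count-subset {A} {P} {Q} _≟_ Q⊆P dec (L , u , p , _) =
  _ , List.filter Q? L , Uniqueₚ.filter⁺ Q? u ,
  (λ x → mk⇔ (proj₂ ∘ ∈-filter⁻ Q? {xs = L}) (λ q → ∈-filter⁺ Q? (from (p x) (Q⊆P x q)) q)) , refl
  where
  open import Data.List.Membership.DecPropositional _≟_ using (_∈?_)
  Q? : ∀ x → Dec (Q x)
  Q? x with x ∈? L
  ... | yes x∈L = dec x (to (p x) x∈L)
  ... | no x∉L = no (λ q → x∉L (from (p x) (Q⊆P x q)))

-- Finite differences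

-- Backward difference with the convention f(-1) = 0, that is, multiplication of the generating
-- function by 1 - λ.
Δ : (ℕ → ℤ) → ℕ → ℤ
Δ f zero = f 0
Δ f (suc n) = f (suc n) ℤ.- f n

Δ^ : ℕ → (ℕ → ℤ) → ℕ → ℤ
Δ^ zero f = f
Δ^ (suc D) f = Δ (Δ^ D f)

Δ-cong : ∀ {f g} → (∀ n → f n ≡ g n) → ∀ n → Δ f n ≡ Δ g n
Δ-cong f≗g zero = f≗g 0
Δ-cong f≗g (suc n) = cong₂ ℤ._-_ (f≗g (suc n)) (f≗g n)

sumTo-cong : ∀ {f g} → (∀ t → f t ≡ g t) → ∀ T → sumTo f T ≡ sumTo g T
sumTo-cong f≗g zero = f≗g 0
sumTo-cong f≗g (suc T) = cong₂ ℤ._+_ (sumTo-cong f≗g T) (f≗g (suc T))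

sumTo-zero : ∀ T → sumTo (λ _ → + 0) T ≡ + 0
sumTo-zero zero = refl
sumTo-zero (suc T) = trans (ℤₚ.+-identityʳ _) (sumTo-zero T)

sumTo-head : ∀ f T → sumTo f (suc T) ≡ f 0 ℤ.+ sumTo (f ∘ suc) T
sumTo-head f zero = refl
sumTo-head f (suc T) =
  trans (cong (ℤ._+ f (suc (suc T))) (sumTo-head f T)) (ℤₚ.+-assoc (f 0) _ _)

sumTo-- : ∀ f g T → sumTo f T ℤ.- sumTo g T ≡ sumTo (λ t → f t ℤ.- g t) T
sumTo-- f g zero = refl
sumTo-- f g (suc T) =
  trans (rearrange (sumTo f T) _ _ _) (cong (ℤ._+ (f (suc T) ℤ.- g (suc T))) (sumTo-- f g T))
  where
  rearrange : ∀ a b c e → (a ℤ.+ b) ℤ.- (c ℤ.+ e) ≡ (a ℤ.- c) ℤ.+ (b ℤ.- e)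
  rearrange = ℤSolver.solve-∀

alternating : ℕ → (ℕ → ℤ) → ℕ → ℕ → ℤ
alternating D f j t = sign t ℤ.* (+ (D C t) ℤ.* f (j ∸ t))

alternating-pascal : ∀ D f j t →
  alternating D f (suc j) (suc t) ℤ.- alternating D f j t ≡ alternating (suc D) f (suc j) (suc t)
alternating-pascal D f j t =
  trans (rearrange (sign t) (+ (D C t)) (+ (D C suc t)) (f (j ∸ t)))
    (cong (λ b → ℤ.- sign t ℤ.* (b ℤ.* f (j ∸ t)))
      (trans (sym (ℤₚ.pos-+ (D C t) (D C suc t))) (cong +_ (nCk+nC[k+1]≡[n+1]C[k+1] D t))))
  where
  rearrange : ∀ s a b x →
    ℤ.- s ℤ.* (b ℤ.* x) ℤ.- s ℤ.* (a ℤ.* x) ≡ ℤ.- s ℤ.* ((a ℤ.+ b) ℤ.* x)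
  rearrange = ℤSolver.solve-∀

-- The binomial expansion of (1 - λ)^D. The inductive step splits off the term t = 0 and applies
-- Pascal's rule to the rest.
Δ^-expand : ∀ D f j → Δ^ D f j ≡ sumTo (alternating D f j) j
Δ^-expand zero f zero = sym (trans (ℤₚ.*-identityˡ _) (ℤₚ.*-identityˡ _))
Δ^-expand zero f (suc j) = sym (begin
  sumTo (alternating 0 f (suc j)) (suc j)
    ≡⟨ sumTo-head (alternating 0 f (suc j)) j ⟩
  alternating 0 f (suc j) 0 ℤ.+ sumTo (alternating 0 f (suc j) ∘ suc) j
    ≡⟨ cong₂ ℤ._+_ (trans (ℤₚ.*-identityˡ (+ 1 ℤ.* f (suc j))) (ℤₚ.*-identityˡ (f (suc j))))
         (trans (sumTo-cong (λ t → vanish t) j) (sumTo-zero j)) ⟩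
  f (suc j) ℤ.+ + 0
    ≡⟨ ℤₚ.+-identityʳ _ ⟩
  f (suc j) ∎)
  where
  open ≡-Reasoning
  vanish : ∀ t → alternating 0 f (suc j) (suc t) ≡ + 0
  vanish t rewrite k>n⇒nCk≡0 {0} {suc t} z<s =
    trans (cong (ℤ._*_ (ℤ.- sign t)) (ℤₚ.*-zeroˡ (f (j ∸ t)))) (ℤₚ.*-zeroʳ (ℤ.- sign t))
Δ^-expand (suc D) f zero = Δ^-expand D f zero
Δ^-expand (suc D) f (suc j) = begin
  Δ^ D f (suc j) ℤ.- Δ^ D f j
    ≡⟨ cong₂ ℤ._-_ (Δ^-expand D f (suc j)) (Δ^-expand D f j) ⟩
  sumTo (alternating D f (suc j)) (suc j) ℤ.- sumTo (alternating D f j) j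
    ≡⟨ cong (ℤ._- sumTo (alternating D f j) j) (sumTo-head (alternating D f (suc j)) j) ⟩
  (alternating D f (suc j) 0 ℤ.+ sumTo (alternating D f (suc j) ∘ suc) j)
    ℤ.- sumTo (alternating D f j) j
    ≡⟨ ℤₚ.+-assoc (alternating D f (suc j) 0) _ _ ⟩
  alternating D f (suc j) 0 ℤ.+
    (sumTo (alternating D f (suc j) ∘ suc) j ℤ.- sumTo (alternating D f j) j)
    ≡⟨ cong (ℤ._+_ (alternating D f (suc j) 0))
         (trans (sumTo-- (alternating D f (suc j) ∘ suc) (alternating D f j) j)
           (sumTo-cong (alternating-pascal D f j) j)) ⟩
  alternating (suc D) f (suc j) 0 ℤ.+ sumTo (alternating (suc D) f (suc j) ∘ suc) j
    ≡⟨ sumTo-head (alternating (suc D) f (suc j)) j ⟨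
  sumTo (alternating (suc D) f (suc j)) (suc j) ∎
  where open ≡-Reasoning

deltaCoeff≡Δ^ : ∀ d i j → deltaCoeff d i j ≡ Δ^ (suc d) (λ n → + i n) j
deltaCoeff≡Δ^ d i j = sym (Δ^-expand (suc d) (λ n → + i n) j)

-- Lattice vectors

infixl 6 _⊕_
infixl 7 _·_

_⊕_ : ∀ {d} → Vec ℤ d → Vec ℤ d → Vec ℤ d
_⊕_ = zipWith ℤ._+_

_·_ : ∀ {d} → ℤ → Vec ℤ d → Vec ℤ d
k · v = map (k ℤ.*_) v

𝟘 : ∀ {d} → Vec ℤ d
𝟘 = replicate _ (+ 0)

⊕-identityˡ : ∀ {d} (u : Vec ℤ d) → 𝟘 ⊕ u ≡ u
⊕-identityˡ = Vecₚ.zipWith-identityˡ ℤₚ.+-identityˡ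

⊕-identityʳ : ∀ {d} (u : Vec ℤ d) → u ⊕ 𝟘 ≡ u
⊕-identityʳ = Vecₚ.zipWith-identityʳ ℤₚ.+-identityʳ

⊕-assoc : ∀ {d} (u v w : Vec ℤ d) → u ⊕ v ⊕ w ≡ u ⊕ (v ⊕ w)
⊕-assoc = Vecₚ.zipWith-assoc ℤₚ.+-assoc

⊕-interchange : ∀ {d} (a b c e : Vec ℤ d) → (a ⊕ b) ⊕ (c ⊕ e) ≡ (a ⊕ c) ⊕ (b ⊕ e)
⊕-interchange [] [] [] [] = refl
⊕-interchange (a ∷ as) (b ∷ bs) (c ∷ cs) (e ∷ es) =
  cong₂ _∷_ (rearrange a b c e) (⊕-interchange as bs cs es)
  where
  rearrange : ∀ a b c e → (a ℤ.+ b) ℤ.+ (c ℤ.+ e) ≡ (a ℤ.+ c) ℤ.+ (b ℤ.+ e)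
  rearrange = ℤSolver.solve-∀

⊕-cancelˡ : ∀ {d} (u : Vec ℤ d) {v w} → u ⊕ v ≡ u ⊕ w → v ≡ w
⊕-cancelˡ [] {[]} {[]} _ = refl
⊕-cancelˡ (x ∷ u) {y ∷ v} {z ∷ w} eq = cong₂ _∷_
  (trans (cancel x y) (trans (cong (ℤ._- x) (Vecₚ.∷-injectiveˡ eq)) (sym (cancel x z))))
  (⊕-cancelˡ u (Vecₚ.∷-injectiveʳ eq))
  where
  cancel : ∀ x y → y ≡ x ℤ.+ y ℤ.- x
  cancel = ℤSolver.solve-∀

⊕-inverse : ∀ {d} (u v : Vec ℤ d) → u ⊕ v ⊕ (ℤ.- + 1) · v ≡ u
⊕-inverse [] [] = refl
⊕-inverse (x ∷ u) (y ∷ v) = cong₂ _∷_ (cancel x y) (⊕-inverse u v)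
  where
  cancel : ∀ x y → x ℤ.+ y ℤ.+ ℤ.- + 1 ℤ.* y ≡ x
  cancel = ℤSolver.solve-∀

·-distribˡ : ∀ {d} k (u v : Vec ℤ d) → k · (u ⊕ v) ≡ k · u ⊕ k · v
·-distribˡ k [] [] = refl
·-distribˡ k (x ∷ u) (y ∷ v) = cong₂ _∷_ (ℤₚ.*-distribˡ-+ k x y) (·-distribˡ k u v)

·-distribʳ : ∀ {d} k l (u : Vec ℤ d) → (k ℤ.+ l) · u ≡ k · u ⊕ l · u
·-distribʳ k l [] = refl
·-distribʳ k l (x ∷ u) = cong₂ _∷_ (ℤₚ.*-distribʳ-+ x k l) (·-distribʳ k l u)

·-assoc : ∀ {d} k l (u : Vec ℤ d) → (k ℤ.* l) · u ≡ k · (l · u)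
·-assoc k l [] = refl
·-assoc k l (x ∷ u) = cong₂ _∷_ (ℤₚ.*-assoc k l x) (·-assoc k l u)

·-identity : ∀ {d} (u : Vec ℤ d) → + 1 · u ≡ u
·-identity [] = refl
·-identity (x ∷ u) = cong₂ _∷_ (ℤₚ.*-identityˡ x) (·-identity u)

·-zeroˡ : ∀ {d} (u : Vec ℤ d) → + 0 · u ≡ 𝟘
·-zeroˡ [] = refl
·-zeroˡ (x ∷ u) = cong₂ _∷_ (ℤₚ.*-zeroˡ x) (·-zeroˡ u)

·-zeroʳ : ∀ {d} k → k · 𝟘 {d} ≡ 𝟘
·-zeroʳ {zero} k = refl
·-zeroʳ {suc d} k = cong₂ _∷_ (ℤₚ.*-zeroʳ k) (·-zeroʳ k)

ι : ∀ {m} → Vec ℕ m → Vec ℤ m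
ι = map (+_)

sumℤ : ∀ {m} → Vec ℤ m → ℤ
sumℤ [] = + 0
sumℤ (e ∷ es) = e ℤ.+ sumℤ es

sumℤ-ι : ∀ {m} (c : Vec ℕ m) → sumℤ (ι c) ≡ + sum c
sumℤ-ι [] = refl
sumℤ-ι (x ∷ c) = trans (cong (ℤ._+_ (+ x)) (sumℤ-ι c)) (sym (ℤₚ.pos-+ x (sum c)))

sumℤ-⊕ : ∀ {m} (e f : Vec ℤ m) → sumℤ (e ⊕ f) ≡ sumℤ e ℤ.+ sumℤ f
sumℤ-⊕ [] [] = refl
sumℤ-⊕ (x ∷ e) (y ∷ f) = trans (cong (ℤ._+_ (x ℤ.+ y)) (sumℤ-⊕ e f)) (rearrange x y (sumℤ e) (sumℤ f))
  where
  rearrange : ∀ a b c e → (a ℤ.+ b) ℤ.+ (c ℤ.+ e) ≡ (a ℤ.+ c) ℤ.+ (b ℤ.+ e)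
  rearrange = ℤSolver.solve-∀

sumℤ-· : ∀ {m} k (e : Vec ℤ m) → sumℤ (k · e) ≡ k ℤ.* sumℤ e
sumℤ-· k [] = sym (ℤₚ.*-zeroʳ k)
sumℤ-· k (x ∷ e) = trans (cong (ℤ._+_ (k ℤ.* x)) (sumℤ-· k e)) (sym (ℤₚ.*-distribˡ-+ k x (sumℤ e)))

lincomb≡lincombℤ : ∀ {d m} (c : Vec ℕ m) (V : Vec (Vec ℤ d) m) → lincomb c V ≡ lincombℤ (ι c) V
lincomb≡lincombℤ [] [] = refl
lincomb≡lincombℤ (x ∷ c) (v ∷ V) = cong (+ x · v ⊕_) (lincomb≡lincombℤ c V)

lincombℤ-⊕ : ∀ {d m} (e f : Vec ℤ m) (V : Vec (Vec ℤ d) m) →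
  lincombℤ (e ⊕ f) V ≡ lincombℤ e V ⊕ lincombℤ f V
lincombℤ-⊕ [] [] [] = sym (⊕-identityˡ 𝟘)
lincombℤ-⊕ (x ∷ e) (y ∷ f) (v ∷ V) =
  trans (cong₂ _⊕_ (·-distribʳ x y v) (lincombℤ-⊕ e f V)) (⊕-interchange (x · v) (y · v) _ _)

lincombℤ-· : ∀ {d m} k (e : Vec ℤ m) (V : Vec (Vec ℤ d) m) →
  lincombℤ (k · e) V ≡ k · lincombℤ e V
lincombℤ-· k [] [] = sym (·-zeroʳ k)
lincombℤ-· k (x ∷ e) (v ∷ V) =
  trans (cong₂ _⊕_ (·-assoc k x v) (lincombℤ-· k e V)) (sym (·-distribˡ k (x · v) _))

lincomb-zero : ∀ {d m} (V : Vec (Vec ℤ d) m) → lincomb (replicate m 0) V ≡ 𝟘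
lincomb-zero [] = refl
lincomb-zero (v ∷ V) = trans (cong₂ _⊕_ (·-zeroˡ v) (lincomb-zero V)) (⊕-identityˡ 𝟘)

add : ∀ {m} → Fin m → ℕ → Vec ℕ m → Vec ℕ m
add i k c = updateAt c i (λ x → k + x)

sum-zero : ∀ m → sum (replicate m 0) ≡ 0
sum-zero zero = refl
sum-zero (suc m) = sum-zero m

sum-add : ∀ {m} (i : Fin m) k c → sum (add i k c) ≡ k + sum c
sum-add zero k (x ∷ c) = ℕₚ.+-assoc k x (sum c)
sum-add (suc i) k (x ∷ c) = begin
  x + sum (add i k c) ≡⟨ cong (_+_ x) (sum-add i k c) ⟩
  x + (k + sum c) ≡⟨ ℕₚ.+-assoc x k (sum c) ⟨
  x + k + sum c ≡⟨ cong (_+ sum c) (ℕₚ.+-comm x k) ⟩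
  k + x + sum c ≡⟨ ℕₚ.+-assoc k x (sum c) ⟩
  k + (x + sum c) ∎
  where open ≡-Reasoning

lincomb-add : ∀ {d m} (i : Fin m) k c (V : Vec (Vec ℤ d) m) →
  lincomb (add i k c) V ≡ + k · lookup V i ⊕ lincomb c V
lincomb-add zero k (x ∷ c) (v ∷ V) =
  trans (cong (λ z → z · v ⊕ lincomb c V) (ℤₚ.pos-+ k x))
    (trans (cong (_⊕ lincomb c V) (·-distribʳ (+ k) (+ x) v)) (⊕-assoc (+ k · v) _ _))
lincomb-add (suc i) k (x ∷ c) (v ∷ V) = begin
  + x · v ⊕ lincomb (add i k c) V ≡⟨ cong (+ x · v ⊕_) (lincomb-add i k c V) ⟩
  + x · v ⊕ (+ k · lookup V i ⊕ lincomb c V) ≡⟨ ⊕-assoc _ _ _ ⟨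
  + x · v ⊕ + k · lookup V i ⊕ lincomb c V
    ≡⟨ cong (_⊕ lincomb c V) (Vecₚ.zipWith-comm ℤₚ.+-comm _ _) ⟩
  + k · lookup V i ⊕ + x · v ⊕ lincomb c V ≡⟨ ⊕-assoc _ _ _ ⟩
  + k · lookup V i ⊕ (+ x · v ⊕ lincomb c V) ∎
  where open ≡-Reasoning

subtract : ∀ {m} (i : Fin m) {k} c → k ≤ lookup c i → Σ (Vec ℕ m) λ c′ → c ≡ add i k c′
subtract zero {k} (x ∷ c) k≤x = x ∸ k ∷ c , cong (_∷ c) (sym (ℕₚ.m+[n∸m]≡n k≤x))
subtract (suc i) (x ∷ c) k≤ = let (c′ , eq) = subtract i c k≤ in x ∷ c′ , cong (x ∷_) eq

lookup-add : ∀ {m} (i : Fin m) k c → lookup (add i k c) i ≡ k + lookup c i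
lookup-add i k c = Vecₚ.lookup∘updateAt i c

lookup-add-≢ : ∀ {m} {i j : Fin m} k c → i ≢ j → lookup (add j k c) i ≡ lookup c i
lookup-add-≢ {i = i} {j} k c i≢j = Vecₚ.lookup∘updateAt′ i j i≢j c

-- Affine independence and half-open boxes

AffineIndependent : ∀ {d m} → Vec (Vec ℤ d) m → Set
AffineIndependent {m = m} W =
  (e : Vec ℤ m) → lincombℤ e W ≡ 𝟘 → sumℤ e ≡ + 0 → e ≡ 𝟘

lincombℤ-translate : ∀ {d m} (e : Vec ℤ m) (V : Vec (Vec ℤ d) m) v →
  lincombℤ e (map (λ u → zipWith ℤ._-_ u v) V) ≡ lincombℤ e V ⊕ (ℤ.- sumℤ e) · v
lincombℤ-translate [] [] v = sym (trans (cong (𝟘 ⊕_) (·-zeroˡ v)) (⊕-identityˡ 𝟘))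
lincombℤ-translate (x ∷ e) (u ∷ V) v =
  trans (cong (x · zipWith ℤ._-_ u v ⊕_) (lincombℤ-translate e V v)) (rearrange u v (lincombℤ e V))
  where
  rearrange₁ : ∀ x s p q r →
    x ℤ.* (p ℤ.- q) ℤ.+ (r ℤ.+ ℤ.- s ℤ.* q) ≡ (x ℤ.* p ℤ.+ r) ℤ.+ ℤ.- (x ℤ.+ s) ℤ.* q
  rearrange₁ = ℤSolver.solve-∀
  rearrange : ∀ {d} (u v w : Vec ℤ d) →
    x · zipWith ℤ._-_ u v ⊕ (w ⊕ (ℤ.- sumℤ e) · v) ≡ (x · u ⊕ w) ⊕ (ℤ.- (x ℤ.+ sumℤ e)) · v
  rearrange [] [] [] = refl
  rearrange (p ∷ u) (q ∷ v) (r ∷ w) = cong₂ _∷_ (rearrange₁ x (sumℤ e) p q r) (rearrange u v w)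

-- As the coefficients sum to 0, that of `v` is minus the sum of the others, which turns the
-- relation into one between the differences u - v.
affineIndependent : ∀ {d m} (v : Vec ℤ d) (V : Vec (Vec ℤ d) m) →
  (∀ e → lincombℤ e (map (λ u → zipWith ℤ._-_ u v) V) ≡ 𝟘 → e ≡ 𝟘) →
  AffineIndependent (v ∷ V)
affineIndependent {m = m} v V indep (x ∷ e) comb≡0 sum≡0 = cong₂ _∷_ x≡0 e≡0
  where
  x≡-sum : x ≡ ℤ.- sumℤ e
  x≡-sum = trans (rearrange x (sumℤ e)) (trans (cong (ℤ._+ ℤ.- sumℤ e) sum≡0) (ℤₚ.+-identityˡ _))
    where
    rearrange : ∀ x s → x ≡ x ℤ.+ s ℤ.+ ℤ.- s
    rearrange = ℤSolver.solve-∀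
  e≡0 : e ≡ 𝟘
  e≡0 = indep e (begin
    lincombℤ e (map (λ u → zipWith ℤ._-_ u v) V) ≡⟨ lincombℤ-translate e V v ⟩
    lincombℤ e V ⊕ (ℤ.- sumℤ e) · v ≡⟨ cong (λ z → lincombℤ e V ⊕ z · v) x≡-sum ⟨
    lincombℤ e V ⊕ x · v ≡⟨ Vecₚ.zipWith-comm ℤₚ.+-comm _ _ ⟩
    x · v ⊕ lincombℤ e V ≡⟨ comb≡0 ⟩
    𝟘 ∎)
    where open ≡-Reasoning
  sumℤ-𝟘 : ∀ m → sumℤ (𝟘 {m}) ≡ + 0
  sumℤ-𝟘 zero = refl
  sumℤ-𝟘 (suc m) = trans (ℤₚ.+-identityˡ _) (sumℤ-𝟘 m)
  x≡0 : x ≡ + 0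
  x≡0 = trans x≡-sum (cong ℤ.-_ (trans (cong sumℤ e≡0) (sumℤ-𝟘 m)))

-- The point x lies in n · conv W with its first s barycentric coordinates c_i / N less than 1.
Box : ∀ {d m} → Vec (Vec ℤ d) m → ℕ → ℕ → Vec ℤ d → Set
Box {m = m} W s n x =
  Σ ℕ λ N → (0 < N) × Σ (Vec ℕ m) λ c →
    (sum c ≡ N * n) × (+ N · x ≡ lincomb c W) × (∀ i → toℕ i < s → lookup c i < N)

inDilate⇔box : ∀ {d m} (W : Vec (Vec ℤ d) m) n x → InDilate W n x ⇔ Box W 0 n x
inDilate⇔box W n x = mk⇔
  (λ (N , N>0 , c , s , r) → N , N>0 , c , s , r , λ i ())
  (λ (N , N>0 , c , s , r , _) → N , N>0 , c , s , r)

-- `N′` times `c` minus `N` times `c′` is an affine relation among the vertices, hence zero. The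
-- result is cross-multiplied because the two representations may have different denominators.
coordinates-unique : ∀ {d m} (W : Vec (Vec ℤ d) m) → AffineIndependent W → ∀ n x N N′ c c′ →
  sum c ≡ N * n → + N · x ≡ lincomb c W →
  sum c′ ≡ N′ * n → + N′ · x ≡ lincomb c′ W →
  ∀ i → N′ * lookup c i ≡ N * lookup c′ i
coordinates-unique W indep n x N N′ c c′ s r s′ r′ i = ℤₚ.+-injective (begin
  + (N′ * lookup c i) ≡⟨ ℤₚ.pos-* N′ _ ⟩
  + N′ ℤ.* + lookup c i ≡⟨ difference (+ N′) (+ N) (+ lookup c i) (+ lookup c′ i) ⟨
  (+ N′ ℤ.* + lookup c i ℤ.+ ℤ.- + N ℤ.* + lookup c′ i) ℤ.+ + N ℤ.* + lookup c′ i
    ≡⟨ cong (ℤ._+ + N ℤ.* + lookup c′ i) zeroᵢ ⟩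
  + 0 ℤ.+ + N ℤ.* + lookup c′ i ≡⟨ ℤₚ.+-identityˡ _ ⟩
  + N ℤ.* + lookup c′ i ≡⟨ ℤₚ.pos-* N _ ⟨
  + (N * lookup c′ i) ∎)
  where
  open ≡-Reasoning
  difference : ∀ p q y z → (p ℤ.* y ℤ.+ ℤ.- q ℤ.* z) ℤ.+ q ℤ.* z ≡ p ℤ.* y
  difference = ℤSolver.solve-∀
  cross : ∀ p q n → p ℤ.* (q ℤ.* n) ℤ.+ ℤ.- q ℤ.* (p ℤ.* n) ≡ + 0
  cross = ℤSolver.solve-∀
  cross-· : ∀ {d} p q (x : Vec ℤ d) → p · (q · x) ⊕ (ℤ.- q) · (p · x) ≡ 𝟘
  cross-· p q [] = refl
  cross-· p q (y ∷ x) = cong₂ _∷_ (cross p q y) (cross-· p q x)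
  e : Vec ℤ _
  e = + N′ · ι c ⊕ (ℤ.- + N) · ι c′
  lincomb-e : lincombℤ e W ≡ 𝟘
  lincomb-e = begin
    lincombℤ e W ≡⟨ lincombℤ-⊕ (+ N′ · ι c) _ W ⟩
    lincombℤ (+ N′ · ι c) W ⊕ lincombℤ ((ℤ.- + N) · ι c′) W
      ≡⟨ cong₂ _⊕_ (lincombℤ-· (+ N′) (ι c) W) (lincombℤ-· (ℤ.- + N) (ι c′) W) ⟩
    + N′ · lincombℤ (ι c) W ⊕ (ℤ.- + N) · lincombℤ (ι c′) W
      ≡⟨ cong₂ (λ u v → + N′ · u ⊕ (ℤ.- + N) · v)
           (trans r (lincomb≡lincombℤ c W)) (trans r′ (lincomb≡lincombℤ c′ W)) ⟨
    + N′ · (+ N · x) ⊕ (ℤ.- + N) · (+ N′ · x) ≡⟨ cross-· (+ N′) (+ N) x ⟩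
    𝟘 ∎
  sum-ι : ∀ {N c} → sum c ≡ N * n → sumℤ (ι c) ≡ + N ℤ.* + n
  sum-ι {N} {c} eq = trans (sumℤ-ι c) (trans (cong +_ eq) (ℤₚ.pos-* N n))
  sum-e : sumℤ e ≡ + 0
  sum-e = begin
    sumℤ e ≡⟨ sumℤ-⊕ (+ N′ · ι c) _ ⟩
    sumℤ (+ N′ · ι c) ℤ.+ sumℤ ((ℤ.- + N) · ι c′)
      ≡⟨ cong₂ ℤ._+_ (sumℤ-· (+ N′) (ι c)) (sumℤ-· (ℤ.- + N) (ι c′)) ⟩
    + N′ ℤ.* sumℤ (ι c) ℤ.+ ℤ.- + N ℤ.* sumℤ (ι c′)
      ≡⟨ cong₂ (λ y z → + N′ ℤ.* y ℤ.+ ℤ.- + N ℤ.* z) (sum-ι {N} {c} s) (sum-ι {N′} {c′} s′) ⟩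
    + N′ ℤ.* (+ N ℤ.* + n) ℤ.+ ℤ.- + N ℤ.* (+ N′ ℤ.* + n) ≡⟨ cross (+ N′) (+ N) (+ n) ⟩
    + 0 ∎
  lookup-e : lookup e i ≡ + N′ ℤ.* + lookup c i ℤ.+ ℤ.- + N ℤ.* + lookup c′ i
  lookup-e = trans (Vecₚ.lookup-zipWith ℤ._+_ i (+ N′ · ι c) _)
    (cong₂ ℤ._+_
      (trans (Vecₚ.lookup-map i _ (ι c)) (cong (ℤ._*_ (+ N′)) (Vecₚ.lookup-map i (+_) c)))
      (trans (Vecₚ.lookup-map i _ (ι c′)) (cong (ℤ._*_ (ℤ.- + N)) (Vecₚ.lookup-map i (+_) c′))))
  zeroᵢ : + N′ ℤ.* + lookup c i ℤ.+ ℤ.- + N ℤ.* + lookup c′ i ≡ + 0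
  zeroᵢ = trans (sym lookup-e)
    (trans (cong (λ v → lookup v i) (indep e lincomb-e sum-e)) (Vecₚ.lookup-replicate i (+ 0)))

-- Removing one vertex at a time

-- The points with coordinate at least 1 at vertex `i`, described by what is left after subtracting
-- that vertex. At height 0 there are none, since the coordinates sum to 0.
Shifted : ∀ {d m} → Vec (Vec ℤ d) m → Fin m → ℕ → Vec ℤ d → Set
Shifted W i zero x = ⊥
Shifted W i (suc n) x = Σ _ λ x′ → x ≡ lookup W i ⊕ x′ × Box W (toℕ i) n x′

box-shift : ∀ {d m} (W : Vec (Vec ℤ d) m) i n x N c →
  sum c ≡ N * n → + N · x ≡ lincomb c W →
  sum (add i N c) ≡ N * suc n × + N · (lookup W i ⊕ x) ≡ lincomb (add i N c) W
box-shift W i n x N c s r =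
  trans (sum-add i N c) (trans (cong (_+_ N) s) (sym (ℕₚ.*-suc N n))) ,
  trans (·-distribˡ (+ N) (lookup W i) x)
    (trans (cong (+ N · lookup W i ⊕_) r) (sym (lincomb-add i N c W)))

box-unshift : ∀ {d m} (W : Vec (Vec ℤ d) m) i n x N c →
  sum (add i N c) ≡ N * suc n → + N · x ≡ lincomb (add i N c) W →
  Σ _ λ x′ → x ≡ lookup W i ⊕ x′ × sum c ≡ N * n × + N · x′ ≡ lincomb c W
box-unshift W i n x N c s r =
  x′ , x≡ ,
  ℕₚ.+-cancelˡ-≡ N _ _ (trans (sym (sum-add i N c)) (trans s (ℕₚ.*-suc N n))) ,
  ⊕-cancelˡ (+ N · v) (begin
    + N · v ⊕ + N · x′ ≡⟨ ·-distribˡ (+ N) v x′ ⟨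
    + N · (v ⊕ x′) ≡⟨ cong (+ N ·_) x≡ ⟨
    + N · x ≡⟨ r ⟩
    lincomb (add i N c) W ≡⟨ lincomb-add i N c W ⟩
    + N · v ⊕ lincomb c W ∎)
  where
  open ≡-Reasoning
  v = lookup W i
  x′ = x ⊕ (ℤ.- + 1) · v
  x≡ : x ≡ v ⊕ x′
  x≡ = sym (trans (sym (⊕-assoc v x _))
    (trans (cong (_⊕ (ℤ.- + 1) · v) (Vecₚ.zipWith-comm ℤₚ.+-comm v x)) (⊕-inverse x v)))

-- If c_i ≥ N, subtracting `N` from c_i subtracts the vertex from the point and 1 from the height,
-- and changes no other coordinate.
box-split : ∀ {d m} (W : Vec (Vec ℤ d) m) i n x →
  Box W (toℕ i) n x ⇔ (Box W (suc (toℕ i)) n x ⊎ Shifted W i n x)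
box-split W i n x = mk⇔ (split n) (unsplit n)
  where
  split : ∀ n → Box W (toℕ i) n x → Box W (suc (toℕ i)) n x ⊎ Shifted W i n x
  split n (N , N>0 , c , s , r , small) with lookup c i <? N
  ... | yes cᵢ<N = inj₁ (N , N>0 , c , s , r , small′)
    where
    small′ : ∀ j → toℕ j < suc (toℕ i) → lookup c j < N
    small′ j j<1+i with ℕₚ.m<1+n⇒m<n∨m≡n j<1+i
    ... | inj₁ j<i = small j j<i
    ... | inj₂ j≡i = subst (λ j → lookup c j < N) (sym (Finₚ.toℕ-injective j≡i)) cᵢ<N
  ... | no cᵢ≮N with subtract i c (ℕₚ.≮⇒≥ cᵢ≮N)
  -- At height 0 the coefficients sum to 0, against c_i ≥ N > 0.
  split zero (N , N>0 , _ , s , r , small) | no _ | c , refl =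
    ⊥-elim (ℕₚ.<⇒≢ (ℕₚ.<-≤-trans N>0 (ℕₚ.m≤m+n N (sum c)))
      (sym (trans (sym (sum-add i N c)) (trans s (ℕₚ.*-zeroʳ N)))))
  split (suc n) (N , N>0 , _ , s , r , small) | no _ | c , refl =
    let (x′ , x≡ , s′ , r′) = box-unshift W i n x N c s r in
    inj₂ (x′ , x≡ , N , N>0 , c , s′ , r′ , λ j j<i →
      subst (_< N) (lookup-add-≢ N c (ℕₚ.<⇒≢ j<i ∘ cong toℕ)) (small j j<i))
  unsplit : ∀ n → Box W (suc (toℕ i)) n x ⊎ Shifted W i n x → Box W (toℕ i) n x
  unsplit n (inj₁ (N , N>0 , c , s , r , small)) =
    N , N>0 , c , s , r , λ j j<i → small j (ℕₚ.m<n⇒m<1+n j<i)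
  unsplit (suc n) (inj₂ (x′ , refl , N , N>0 , c , s , r , small)) =
    let (s′ , r′) = box-shift W i n x′ N c s r in
    N , N>0 , add i N c , s′ , r′ , λ j j<i →
      subst (_< N) (sym (lookup-add-≢ N c (ℕₚ.<⇒≢ j<i ∘ cong toℕ))) (small j j<i)

-- By uniqueness both descriptions give the same coordinate at `i`, which would be below 1 by one
-- and at least 1 by the other.
box-disjoint : ∀ {d m} (W : Vec (Vec ℤ d) m) → AffineIndependent W → ∀ i n x →
  Box W (suc (toℕ i)) n x → ¬ Shifted W i n x
box-disjoint W indep i (suc n) _
  (N , N>0 , c , s , r , small) (x′ , refl , N′ , N′>0 , c′ , s′ , r′ , _) =
  ℕₚ.<-irrefl (coordinates-unique W indep (suc n) (lookup W i ⊕ x′) N N′ c (add i N′ c′)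
    s r (proj₁ shifted) (proj₂ shifted) i) (begin-strict
    N′ * lookup c i <⟨ ℕₚ.*-monoʳ-< N′ {{ℕ.>-nonZero N′>0}} (small i (ℕₚ.n<1+n (toℕ i))) ⟩
    N′ * N ≡⟨ ℕₚ.*-comm N′ N ⟩
    N * N′ ≤⟨ ℕₚ.*-monoʳ-≤ N (ℕₚ.m≤m+n N′ (lookup c′ i)) ⟩
    N * (N′ + lookup c′ i) ≡⟨ cong (N *_) (lookup-add i N′ c′) ⟨
    N * lookup (add i N′ c′) i ∎)
  where
  open ℕₚ.≤-Reasoning
  shifted = box-shift W i n x′ N′ c′ s′ r′

delay : (ℕ → ℕ) → ℕ → ℕ
delay f zero = 0
delay f (suc n) = f n

count-shifted : ∀ {d m} (W : Vec (Vec ℤ d) m) i {f} →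
  (∀ n → Count (Box W (toℕ i) n) (f n)) → ∀ n → Count (Shifted W i n) (delay f n)
count-shifted W i counts zero = count-∅ (λ x ())
count-shifted W i counts (suc n) = count-image (lookup W i ⊕_) (⊕-cancelˡ (lookup W i)) (counts n)

-- In generating functions, f = g + λ f gives (1 - λ) f = g.
Δ-delay : ∀ {f g : ℕ → ℕ} → (∀ n → f n ≡ g n + delay f n) → ∀ n → Δ (λ n → + f n) n ≡ + g n
Δ-delay {f} {g} eq zero = cong (+_) (trans (eq 0) (ℕₚ.+-identityʳ (g 0)))
Δ-delay {f} {g} eq (suc n) =
  trans (cong (λ z → + z ℤ.- + f n) (eq (suc n)))
    (trans (cong (ℤ._- + f n) (ℤₚ.pos-+ (g (suc n)) (f n))) (cancel (+ g (suc n)) (+ f n)))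
  where
  cancel : ∀ x y → x ℤ.+ y ℤ.- y ≡ x
  cancel = ℤSolver.solve-∀

peel : ∀ {d m} (W : Vec (Vec ℤ d) m) → AffineIndependent W → ∀ i {f} →
  (∀ n → Count (Box W (toℕ i) n) (f n)) →
  Σ (ℕ → ℕ) λ g → (∀ n → Count (Box W (suc (toℕ i)) n) (g n)) × (∀ n → Δ (λ n → + f n) n ≡ + g n)
peel W indep i {f} counts =
  (λ n → proj₁ (sub n)) , (λ n → proj₂ (sub n)) ,
  Δ-delay {f} {λ n → proj₁ (sub n)} (λ n → count-unique (box-split W i n) (counts n)
    (count-⊎ (box-disjoint W indep i n) (proj₂ (sub n)) (count-shifted W i counts n)))
  where
  -- The box condition is existential over representations. `box-split` exhibits one alternative for
  -- the given point, and disjointness makes the second one a refutation of the first.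
  decide : ∀ n x → Box W (toℕ i) n x → Dec (Box W (suc (toℕ i)) n x)
  decide n x b with to (box-split W i n x) b
  ... | inj₁ b′ = yes b′
  ... | inj₂ sh = no (λ b′ → box-disjoint W indep i n x b′ sh)
  sub : ∀ n → ∃ (Count (Box W (suc (toℕ i)) n))
  sub n = count-subset (Vecₚ.≡-dec ℤ._≟_) (λ x → from (box-split W i n x) ∘ inj₁) (decide n) (counts n)

-- Here the smaller boxes are counted first and the larger ones are assembled as partial sums. This
-- yields the lattice counts of the constructed simplex without a direct enumeration of its dilates.
unpeel : ∀ {d m} (W : Vec (Vec ℤ d) m) → AffineIndependent W → ∀ i {g} →
  (∀ n → Count (Box W (suc (toℕ i)) n) (g n)) →
  Σ (ℕ → ℕ) λ f → (∀ n → Count (Box W (toℕ i) n) (f n)) × (∀ n → Δ (λ n → + f n) n ≡ + g n)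
unpeel W indep i {g} counts = f , countf , Δ-delay {f} {g} f-delay
  where
  f : ℕ → ℕ
  -- The added 0 is the count of the empty shifted part, so that `f` agrees definitionally with what
  -- `glue` produces.
  f zero = g 0 + 0
  f (suc n) = g (suc n) + f n
  f-delay : ∀ n → f n ≡ g n + delay f n
  f-delay zero = refl
  f-delay (suc n) = refl
  glue : ∀ n {k} → Count (Shifted W i n) k → Count (Box W (toℕ i) n) (g n + k)
  glue n sh = count-cong (λ x → mk⇔ (from (box-split W i n x)) (to (box-split W i n x)))
    (count-⊎ (box-disjoint W indep i n) (counts n) sh)
  countf : ∀ n → Count (Box W (toℕ i) n) (f n)
  countf zero = glue 0 (count-∅ (λ x ()))
  countf (suc n) = glue (suc n) (count-image (lookup W i ⊕_) (⊕-cancelˡ (lookup W i)) (countf n))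

peel-iterate : ∀ {d m} (W : Vec (Vec ℤ d) m) → AffineIndependent W → ∀ {f} s → s ≤ m →
  (∀ n → Count (Box W 0 n) (f n)) →
  Σ (ℕ → ℕ) λ g → (∀ n → Count (Box W s n) (g n)) × (∀ n → Δ^ s (λ n → + f n) n ≡ + g n)
peel-iterate W indep {f} zero _ counts = f , counts , λ n → refl
peel-iterate W indep (suc s) s<m counts
  with g , countg , Δg ← peel-iterate W indep s (ℕₚ.<⇒≤ s<m) counts
  with h , counth , Δh ← peel W indep (Fin.fromℕ< s<m)
    (subst (λ s → ∀ n → Count (Box W s n) (g n)) (sym (Finₚ.toℕ-fromℕ< s<m)) countg) =
  h , subst (λ s → ∀ n → Count (Box W (suc s) n) (h n)) (Finₚ.toℕ-fromℕ< s<m) counth ,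
  λ n → trans (Δ-cong Δg n) (Δh n)

unpeel-iterate : ∀ {d m} (W : Vec (Vec ℤ d) m) → AffineIndependent W → ∀ {g} s → s ≤ m →
  (∀ n → Count (Box W s n) (g n)) →
  Σ (ℕ → ℕ) λ f → (∀ n → Count (Box W 0 n) (f n)) × (∀ n → Δ^ s (λ n → + f n) n ≡ + g n)
unpeel-iterate W indep {g} zero _ counts = g , counts , λ n → refl
unpeel-iterate W indep {g} (suc s) s<m counts
  with f , countf , Δf ← unpeel W indep (Fin.fromℕ< s<m)
    (subst (λ s → ∀ n → Count (Box W (suc s) n) (g n)) (sym (Finₚ.toℕ-fromℕ< s<m)) counts)
  with h , counth , Δh ← unpeel-iterate W indep s (ℕₚ.<⇒≤ s<m)
    (subst (λ s → ∀ n → Count (Box W s n) (f n)) (Finₚ.toℕ-fromℕ< s<m) countf) =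
  h , counth , λ n → trans (Δ-cong Δh n) (Δf n)

-- Comparing lists of vertices

-- Each coefficient moves to the index in `W` that carries the same vector; coefficients sharing an
-- index accumulate.
recombine : ∀ {d m m′} (V : Vec (Vec ℤ d) m) (W : Vec (Vec ℤ d) m′) →
  (∀ j → ∃ λ i → lookup V j ≡ lookup W i) →
  ∀ c → Σ _ λ c′ → sum c′ ≡ sum c × lincomb c′ W ≡ lincomb c V
recombine {m′ = m′} [] W V⊆W [] = replicate m′ 0 , sum-zero m′ , lincomb-zero W
recombine (v ∷ V) W V⊆W (x ∷ c)
  with i , v≡ ← V⊆W zero
  with c′ , s , r ← recombine V W (V⊆W ∘ suc) c =
  add i x c′ , trans (sum-add i x c′) (cong (_+_ x) s) ,
  trans (lincomb-add i x c′ W) (cong₂ (λ u w → + x · u ⊕ w) (sym v≡) r)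

inDilate-mono : ∀ {d m m′} (V : Vec (Vec ℤ d) m) (W : Vec (Vec ℤ d) m′) →
  (∀ j → ∃ λ i → lookup V j ≡ lookup W i) → ∀ n x → InDilate V n x → InDilate W n x
inDilate-mono V W V⊆W n x (N , N>0 , c , s , r) =
  let (c′ , s′ , r′) = recombine V W V⊆W c in N , N>0 , c′ , trans s′ s , trans r (sym r′)

unit : ∀ {m} → Fin m → Vec ℕ m
unit i = add i 1 (replicate _ 0)

sum-unit : ∀ {m} (i : Fin m) → sum (unit i) ≡ 1
sum-unit {m} i = trans (sum-add i 1 (replicate m 0)) (cong suc (sum-zero m))

lincomb-unit : ∀ {d m} (V : Vec (Vec ℤ d) m) i → + 1 · lookup V i ≡ lincomb (unit i) V
lincomb-unit V i = sym (trans (lincomb-add i 1 (replicate _ 0) V)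
  (trans (cong (+ 1 · lookup V i ⊕_) (lincomb-zero V)) (⊕-identityʳ _)))

vertex-inDilate : ∀ {d m} (V : Vec (Vec ℤ d) m) i → InDilate V 1 (lookup V i)
vertex-inDilate V i = 1 , z<s , unit i , sum-unit i , lincomb-unit V i

-- A common point W_i = W_j has both unit vectors as coordinates; by uniqueness these agree at `i`,
-- which fails for i ≠ j.
affineIndependent⇒injective : ∀ {d m} (W : Vec (Vec ℤ d) m) → AffineIndependent W →
  ∀ i j → lookup W i ≡ lookup W j → i ≡ j
affineIndependent⇒injective W indep i j eq with i Finₚ.≟ j
... | yes i≡j = i≡j
... | no i≢j = ⊥-elim (ℕₚ.1+n≢0 (begin
  1 ≡⟨ cong suc (Vecₚ.lookup-replicate i 0) ⟨
  suc (lookup (replicate _ 0) i) ≡⟨ lookup-add i 1 (replicate _ 0) ⟨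
  lookup (unit i) i ≡⟨ ℕₚ.*-identityˡ _ ⟨
  1 * lookup (unit i) i
    ≡⟨ coordinates-unique W indep 1 (lookup W i) 1 1 (unit i) (unit j) (sum-unit i)
         (lincomb-unit W i) (sum-unit j) (trans (cong (+ 1 ·_) eq) (lincomb-unit W j)) i ⟩
  1 * lookup (unit j) i ≡⟨ ℕₚ.*-identityˡ _ ⟩
  lookup (unit j) i ≡⟨ lookup-add-≢ 1 (replicate _ 0) i≢j ⟩
  lookup (replicate _ 0) i ≡⟨ Vecₚ.lookup-replicate i 0 ⟩
  0 ∎))
  where open ≡-Reasoning

-- Pigeonhole for V_j and the m′ entries of `W` among only m′ lattice points. Two entries of `W`
-- never coincide, so the repeated vector is V_j.
vertices-exhaust : ∀ {d m m′} (V : Vec (Vec ℤ d) m) (W : Vec (Vec ℤ d) m′) → AffineIndependent W →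
  (∀ i → ∃ λ j → lookup W i ≡ lookup V j) → LatticeCount V 1 m′ →
  ∀ j → ∃ λ i → lookup V j ≡ lookup W i
vertices-exhaust V W indep W⊆V (L , _ , complete , len) j =
  collide (Finₚ.pigeonhole (ℕₚ.≤-reflexive (cong suc len)) (λ i → index (member i)))
  where
  member : ∀ i → lookup (lookup V j ∷ W) i ∈ L
  member zero = from (complete _) (vertex-inDilate V j)
  member (suc i) = let (j′ , eq) = W⊆V i in
    subst (_∈ L) (sym eq) (from (complete _) (vertex-inDilate V j′))
  collide : (∃ λ i → ∃ λ i′ → i Fin.< i′ × index (member i) ≡ index (member i′)) →
    ∃ λ i → lookup V j ≡ lookup W i
  collide (zero , suc i , _ , eq) =
    i , Membershipₛ.index-injective (setoid _) (member zero) (member (suc i)) eq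
  collide (suc i , suc i′ , s<s i<i′ , eq) =
    ⊥-elim (ℕₚ.<⇒≢ i<i′ (cong toℕ (affineIndependent⇒injective W indep i i′
      (Membershipₛ.index-injective (setoid _) (member (suc i)) (member (suc i′)) eq))))

-- Replacing positive coordinates r by 1 - r

support : ℕ → ℕ
support zero = 0
support (suc c) = 1

-- For c < N this is `N` times the fractional part of -c / N. A coordinate 0 stays 0, as 1 would
-- leave the box.
complement : ℕ → ℕ → ℕ
complement N zero = 0
complement N (suc c) = N ∸ suc c

complement-+ : ∀ {N c} → c < N → complement N c + c ≡ N * support c
complement-+ {N} {zero} _ = sym (ℕₚ.*-zeroʳ N)
complement-+ {N} {suc c} c<N = trans (ℕₚ.m∸n+n≡m (ℕₚ.<⇒≤ c<N)) (sym (ℕₚ.*-identityʳ N))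

complement-< : ∀ {N c} → c < N → complement N c < N
complement-< {N} {zero} 0<N = 0<N
complement-< {suc N} {suc c} _ = s≤s (ℕₚ.m∸n≤m N c)

complement-ι : ∀ {m N} (c : Vec ℕ m) → (∀ i → lookup c i < N) →
  + N · ι (map support c) ≡ ι c ⊕ ι (map (complement N) c)
complement-ι [] _ = refl
complement-ι {N = N} (x ∷ c) small = cong₂ _∷_
  (begin
    + N ℤ.* + support x ≡⟨ ℤₚ.pos-* N (support x) ⟨
    + (N * support x) ≡⟨ cong (+_) (complement-+ (small zero)) ⟨
    + (complement N x + x) ≡⟨ cong (+_) (ℕₚ.+-comm (complement N x) x) ⟩
    + (x + complement N x) ≡⟨ ℤₚ.pos-+ x (complement N x) ⟩
    + x ℤ.+ + complement N x ∎)
  (complement-ι c (small ∘ suc))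
  where open ≡-Reasoning

support-≤ : ∀ {m} (c : Vec ℕ m) → sum (map support c) ≤ m
support-≤ [] = z≤n
support-≤ (zero ∷ c) = ℕₚ.m≤n⇒m≤1+n (support-≤ c)
support-≤ (suc x ∷ c) = s≤s (support-≤ c)

complement-pos : ∀ {m N} (c : Vec ℕ m) → (∀ i → lookup c i < N) → 0 < sum c →
  0 < sum (map (complement N) c)
complement-pos (zero ∷ c) small pos = complement-pos c (small ∘ suc) pos
complement-pos (suc x ∷ c) small _ = ℕₚ.≤-trans (ℕₚ.m<n⇒0<n∸m (small zero)) (ℕₚ.m≤m+n _ _)

-- The point Σ_{c_i > 0} W_i − x: its positive barycentric coordinates are 1 − c_i / N.
box-complement : ∀ {d m} (W : Vec (Vec ℤ d) m) j x → 0 < j → Box W m j x →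
  Σ ℕ λ h → 0 < h × h + j ≤ m × ∃ (Box W m h)
box-complement {m = m} W j x j>0 (N , N>0 , c , s , r , small) =
  h , h>0 , h+j≤m , x′ , N , N>0 , c′ , sum-c′ , comb-c′ , small′
  where
  instance
    N≢0 : ℕ.NonZero N
    N≢0 = ℕ.>-nonZero N>0
  open ≡-Reasoning
  small-all : ∀ i → lookup c i < N
  small-all i = small i (Finₚ.toℕ<n i)
  u c′ : Vec ℕ m
  u = map support c
  c′ = map (complement N) c
  -- Each positive coefficient and its complement add up to `N`, and `sum u` is the number of
  -- positive coefficients.
  sum-c+c′ : N * sum u ≡ N * j + sum c′
  sum-c+c′ = ℤₚ.+-injective (begin
    + (N * sum u) ≡⟨ ℤₚ.pos-* N (sum u) ⟩
    + N ℤ.* + sum u ≡⟨ cong (ℤ._*_ (+ N)) (sumℤ-ι u) ⟨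
    + N ℤ.* sumℤ (ι u) ≡⟨ sumℤ-· (+ N) (ι u) ⟨
    sumℤ (+ N · ι u) ≡⟨ cong sumℤ (complement-ι c small-all) ⟩
    sumℤ (ι c ⊕ ι c′) ≡⟨ sumℤ-⊕ (ι c) (ι c′) ⟩
    sumℤ (ι c) ℤ.+ sumℤ (ι c′) ≡⟨ cong₂ ℤ._+_ (sumℤ-ι c) (sumℤ-ι c′) ⟩
    + sum c ℤ.+ + sum c′ ≡⟨ ℤₚ.pos-+ (sum c) (sum c′) ⟨
    + (sum c + sum c′) ≡⟨ cong (λ z → + (z + sum c′)) s ⟩
    + (N * j + sum c′) ∎)
  -- The heights of a point and its complement add up to the number of positive coordinates; `h+j≡`
  -- checks that the subtraction does not truncate.
  h : ℕ
  h = sum u ∸ j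
  h+j≡ : h + j ≡ sum u
  h+j≡ = ℕₚ.m∸n+n≡m (ℕₚ.*-cancelˡ-≤ N (ℕₚ.≤-trans (ℕₚ.m≤m+n _ _) (ℕₚ.≤-reflexive (sym sum-c+c′))))
  h+j≤m : h + j ≤ m
  h+j≤m = ℕₚ.≤-trans (ℕₚ.≤-reflexive h+j≡) (support-≤ c)
  sum-c′ : sum c′ ≡ N * h
  sum-c′ = ℕₚ.+-cancelˡ-≡ (N * j) _ _ (begin
    N * j + sum c′ ≡⟨ sum-c+c′ ⟨
    N * sum u ≡⟨ cong (N *_) h+j≡ ⟨
    N * (h + j) ≡⟨ ℕₚ.*-distribˡ-+ N h j ⟩
    N * h + N * j ≡⟨ ℕₚ.+-comm (N * h) _ ⟩
    N * j + N * h ∎)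
  h>0 : 0 < h
  h>0 = ℕₚ.*-cancelˡ-< N 0 h (subst₂ _<_ (sym (ℕₚ.*-zeroʳ N)) sum-c′
    (complement-pos c small-all (subst (0 <_) (sym s) (subst (_< N * j) (ℕₚ.*-zeroʳ N) (ℕₚ.*-monoʳ-< N j>0)))))
  x′ : Vec ℤ _
  x′ = lincomb u W ⊕ (ℤ.- + 1) · x
  x⊕x′ : x ⊕ x′ ≡ lincomb u W
  x⊕x′ = trans (sym (⊕-assoc x _ _))
    (trans (cong (_⊕ (ℤ.- + 1) · x) (Vecₚ.zipWith-comm ℤₚ.+-comm x _)) (⊕-inverse _ x))
  comb-c′ : + N · x′ ≡ lincomb c′ W
  comb-c′ = ⊕-cancelˡ (+ N · x) (begin
    + N · x ⊕ + N · x′ ≡⟨ ·-distribˡ (+ N) x x′ ⟨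
    + N · (x ⊕ x′) ≡⟨ cong (+ N ·_) (trans x⊕x′ (lincomb≡lincombℤ u W)) ⟩
    + N · lincombℤ (ι u) W ≡⟨ lincombℤ-· (+ N) (ι u) W ⟨
    lincombℤ (+ N · ι u) W ≡⟨ cong (λ e → lincombℤ e W) (complement-ι c small-all) ⟩
    lincombℤ (ι c ⊕ ι c′) W ≡⟨ lincombℤ-⊕ (ι c) (ι c′) W ⟩
    lincombℤ (ι c) W ⊕ lincombℤ (ι c′) W
      ≡⟨ cong₂ _⊕_ (trans r (lincomb≡lincombℤ c W)) (lincomb≡lincombℤ c′ W) ⟨
    + N · x ⊕ lincomb c′ W ∎)
  small′ : ∀ i → toℕ i < m → lookup c′ i < N
  small′ i _ = subst (_< N) (sym (Vecₚ.lookup-map i (complement N) c)) (complement-< (small-all i))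

-- The necessity of k ≤ ℓ

deltaSeq-low : ∀ d k l a j → suc j ≤ k → deltaSeq d k l a (suc j) ≡ + 0
deltaSeq-low d k l a j j≤k with suc j ℕ.≤ᵇ k | ℕₚ.≤⇒≤ᵇ j≤k
... | true | _ = refl

<⇒≤ᵇ-false : ∀ {m n} → n < m → (m ℕ.≤ᵇ n) ≡ false
<⇒≤ᵇ-false {m} {n} n<m with m ℕ.≤ᵇ n | ℕₚ.≤ᵇ⇒≤ m n
... | false | _ = refl
... | true | m≤n = ⊥-elim (ℕₚ.<⇒≱ n<m (m≤n _))

deltaSeq-middle : ∀ d k l a j → k < suc j → suc j ≤ d ∸ l → deltaSeq d k l a (suc j) ≡ + a
deltaSeq-middle d k l a j k<j j≤d-l rewrite <⇒≤ᵇ-false k<j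
  with suc j ℕ.≤ᵇ (d ∸ l) | ℕₚ.≤⇒≤ᵇ j≤d-l
... | true | _ = refl

deltaSeq-high : ∀ d k l a j → k < suc j → d ∸ l < suc j → deltaSeq d k l a (suc j) ≡ + 0
deltaSeq-high d k l a j k<j d-l<j rewrite <⇒≤ᵇ-false k<j | <⇒≤ᵇ-false d-l<j = refl

Δ^-at-0 : ∀ s f → Δ^ s f 0 ≡ f 0
Δ^-at-0 zero f = refl
Δ^-at-0 (suc s) f = Δ^-at-0 s f

-- The λ-coefficient of (1 - λ)^s f is f(1) - s f(0). For s = d + 1 this turns δ_0 = 1 and δ_1 = 0
-- into i(1) = d + 1.
Δ^-at-1 : ∀ s f → f 1 ≡ Δ^ s f 1 ℤ.+ + s ℤ.* f 0
Δ^-at-1 zero f = sym (trans (cong (ℤ._+_ (f 1)) (ℤₚ.*-zeroˡ (f 0))) (ℤₚ.+-identityʳ (f 1)))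
Δ^-at-1 (suc s) f = trans (Δ^-at-1 s f) (begin
  Δ^ s f 1 ℤ.+ + s ℤ.* f 0 ≡⟨ rearrange (Δ^ s f 1) (f 0) (+ s) ⟩
  Δ^ s f 1 ℤ.- f 0 ℤ.+ (+ 1 ℤ.+ + s) ℤ.* f 0
    ≡⟨ cong₂ (λ y z → Δ^ s f 1 ℤ.- y ℤ.+ z ℤ.* f 0) (sym (Δ^-at-0 s f)) (sym (ℤₚ.pos-+ 1 s)) ⟩
  Δ^ s f 1 ℤ.- Δ^ s f 0 ℤ.+ + suc s ℤ.* f 0 ∎)
  where
  open ≡-Reasoning
  rearrange : ∀ x y s → x ℤ.+ s ℤ.* y ≡ x ℤ.- y ℤ.+ (+ 1 ℤ.+ s) ℤ.* y
  rearrange = ℤSolver.solve-∀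

count-zero : {A : Set} {P : A → Set} → Count P 0 → ∀ x → ¬ P x
count-zero ([] , _ , p , _) x px with () ← from (p x) px

realizable⇒k≤l : ∀ d k l a → k + l < d → Realizable d (deltaSeq d k l (suc a)) → k ≤ l
realizable⇒k≤l d zero l a _ _ = z≤n
realizable⇒k≤l d k@(suc _) l a k+l<d (m , V , (p , w , indep) , i , counts , δ≡) =
  let (h , h>0 , h+j≤1+d , x , b) = box-complement W (d ∸ l) _ d-l>0 (proj₂ top) in
  ℕₚ.≤-pred (ℕₚ.<-≤-trans (k<h h h>0 x b) (ℕₚ.+-cancelʳ-≤ (d ∸ l) _ _ (begin
    h + (d ∸ l) ≤⟨ h+j≤1+d ⟩
    suc d ≡⟨ cong suc (ℕₚ.m+[n∸m]≡n l≤d) ⟨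
    suc l + (d ∸ l) ∎)))
  where
  open ℕₚ.≤-Reasoning
  -- The d + 1 affinely independent vertices supplied by `FullDim`.
  W : Vec (Vec ℤ d) (suc d)
  W = lookup V p ∷ map (lookup V) w
  W-indep : AffineIndependent W
  W-indep = affineIndependent (lookup V p) (map (lookup V) w)
    (λ e eq → indep e (trans (cong (lincombℤ e) (Vecₚ.map-∘ _ (lookup V) w)) eq))
  W⊆V : ∀ j → ∃ λ j′ → lookup W j ≡ lookup V j′
  W⊆V zero = p , refl
  W⊆V (suc j) = lookup w j , Vecₚ.lookup-map j (lookup V) w
  Δi≡δ : ∀ j → Δ^ (suc d) (λ n → + i n) j ≡ deltaSeq d k l (suc a) j
  Δi≡δ j = trans (sym (deltaCoeff≡Δ^ d i j)) (δ≡ j)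
  i0≡1 : + i 0 ≡ + 1
  i0≡1 = trans (sym (Δ^-at-0 (suc d) (λ n → + i n))) (Δi≡δ 0)
  i1≡1+d : i 1 ≡ suc d
  -- Since `k` is a successor, `deltaSeq` at 1 computes to 0.
  i1≡1+d = ℤₚ.+-injective (trans (Δ^-at-1 (suc d) (λ n → + i n))
    (trans (cong₂ (λ y z → y ℤ.+ + suc d ℤ.* z) (Δi≡δ 1) i0≡1)
      (trans (ℤₚ.+-identityˡ _) (ℤₚ.*-identityʳ (+ suc d)))))
  -- With only d + 1 lattice points in the polytope, every entry of `V` occurs in `W`, so both span
  -- the same dilates and the counts transfer.
  V⊆W : ∀ j → ∃ λ j′ → lookup V j ≡ lookup W j′
  V⊆W = vertices-exhaust V W W-indep W⊆V (subst (LatticeCount V 1) i1≡1+d (counts 1))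
  counts-W : ∀ n → Count (Box W 0 n) (i n)
  counts-W n = count-cong (λ x → mk⇔
    (to (inDilate⇔box W n x) ∘ inDilate-mono V W V⊆W n x)
    (inDilate-mono W V W⊆V n x ∘ from (inDilate⇔box W n x))) (counts n)
  box : Σ (ℕ → ℕ) λ g → (∀ n → Count (Box W (suc d) n) (g n)) ×
    (∀ n → Δ^ (suc d) (λ n → + i n) n ≡ + g n)
  box = peel-iterate W W-indep (suc d) ℕₚ.≤-refl counts-W
  box-count : ∀ n {c} → deltaSeq d k l (suc a) n ≡ + c → Count (Box W (suc d) n) c
  box-count n {c} eq = subst (Count (Box W (suc d) n))
    (ℤₚ.+-injective (trans (sym (proj₂ (proj₂ box) n)) (trans (Δi≡δ n) eq)))
    (proj₁ (proj₂ box) n)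
  l≤d : l ≤ d
  l≤d = ℕₚ.≤-trans (ℕₚ.m≤n+m l k) (ℕₚ.<⇒≤ k+l<d)
  k<d-l : k < d ∸ l
  k<d-l = ℕₚ.m+n≤o⇒m≤o∸n (suc k) k+l<d
  d-l>0 : 0 < d ∸ l
  d-l>0 = ℕₚ.≤-<-trans z≤n k<d-l
  top : ∃ (Box W (suc d) (d ∸ l))
  -- Because k < d - ℓ, the entry at d - ℓ is the positive number `suc a`, so the box at this height
  -- is inhabited.
  top with d ∸ l in eq
  ... | zero = ⊥-elim (ℕₚ.<⇒≢ d-l>0 (sym eq))
  ... | suc j = count-inhabited (box-count (suc j)
    (deltaSeq-middle d k l (suc a) j (subst (k <_) eq k<d-l) (ℕₚ.≤-reflexive (sym eq))))
  k<h : ∀ h → 0 < h → ∀ x → Box W (suc d) h x → k < h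
  k<h (suc h) _ x b with k <? suc h
  ... | yes k<h = k<h
  ... | no k≮h = ⊥-elim (count-zero (box-count (suc h)
    (deltaSeq-low d k l (suc a) h (ℕₚ.≮⇒≥ k≮h))) x b)

-- Simplices with vertices 0, (M, b) and the last unit vectors

basis : ∀ D → Vec (Vec ℤ D) D
basis zero = []
basis (suc D) = (+ 1 ∷ 𝟘) ∷ map (+ 0 ∷_) (basis D)

lincombℤ-embed : ∀ {d m} (e : Vec ℤ m) (V : Vec (Vec ℤ d) m) →
  lincombℤ e (map (+ 0 ∷_) V) ≡ + 0 ∷ lincombℤ e V
lincombℤ-embed [] [] = refl
lincombℤ-embed (x ∷ e) (v ∷ V) = trans (cong ((x · (+ 0 ∷ v)) ⊕_) (lincombℤ-embed e V))
  (cong (_∷ (x · v ⊕ lincombℤ e V)) (trans (ℤₚ.+-identityʳ _) (ℤₚ.*-zeroʳ x)))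

lincombℤ-basis : ∀ {D} (e : Vec ℤ D) → lincombℤ e (basis D) ≡ e
lincombℤ-basis [] = refl
lincombℤ-basis {suc D} (x ∷ e) = trans (cong (x · (+ 1 ∷ 𝟘) ⊕_) (lincombℤ-embed e (basis D)))
  (cong₂ _∷_ (trans (ℤₚ.+-identityʳ _) (ℤₚ.*-identityʳ x))
    (trans (cong₂ _⊕_ (·-zeroʳ x) (lincombℤ-basis e)) (⊕-identityˡ e)))

axes : ∀ {D} → ℕ → Vec ℤ D → Vec (Vec ℤ (suc D)) (suc D)
axes M b = (+ M ∷ b) ∷ map (+ 0 ∷_) (basis _)

simplex : ∀ {D} → ℕ → Vec ℤ D → Vec (Vec ℤ (suc D)) (suc (suc D))
simplex M b = 𝟘 ∷ axes M b

lincombℤ-axes : ∀ {D} M (b : Vec ℤ D) t e →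
  lincombℤ (t ∷ e) (axes M b) ≡ t ℤ.* + M ∷ (t · b ⊕ e)
lincombℤ-axes M b t e = trans (cong (t · (+ M ∷ b) ⊕_) (lincombℤ-embed e (basis _)))
  (cong₂ _∷_ (ℤₚ.+-identityʳ _) (cong (t · b ⊕_) (lincombℤ-basis e)))

-- The matrix of edges is triangular: the first coordinate forces t = 0, and the others are then the
-- coefficients of the unit vectors.
axes-independent : ∀ {D} M (b : Vec ℤ D) e → lincombℤ e (axes (suc M) b) ≡ 𝟘 → e ≡ 𝟘
axes-independent M b (t ∷ e) eq
  with ℤₚ.i*j≡0⇒i≡0∨j≡0 t (Vecₚ.∷-injectiveˡ (trans (sym (lincombℤ-axes (suc M) b t e)) eq))
... | inj₁ refl = cong (+ 0 ∷_) (begin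
  e ≡⟨ ⊕-identityˡ e ⟨
  𝟘 ⊕ e ≡⟨ cong (_⊕ e) (·-zeroˡ b) ⟨
  + 0 · b ⊕ e ≡⟨ Vecₚ.∷-injectiveʳ (trans (sym (lincombℤ-axes (suc M) b (+ 0) e)) eq) ⟩
  𝟘 ∎)
  where open ≡-Reasoning

⊖-identityʳ : ∀ {d} (u : Vec ℤ d) → zipWith ℤ._-_ u 𝟘 ≡ u
⊖-identityʳ = Vecₚ.zipWith-identityʳ ℤₚ.+-identityʳ

-- The base vertex is the origin, so the differences are the vectors of `axes` themselves.
simplex-fullDim : ∀ {D} M (b : Vec ℤ D) → FullDim (simplex (suc M) b)
simplex-fullDim M b = zero , tabulate suc , λ e eq →
  axes-independent M b e (trans (cong (lincombℤ e) (sym edges)) eq)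
  where
  edges : map (λ j → zipWith ℤ._-_ (lookup (simplex (suc M) b) j) 𝟘) (tabulate suc) ≡ axes (suc M) b
  edges = trans (sym (Vecₚ.tabulate-∘ _ suc))
    (trans (Vecₚ.tabulate-cong (λ j → ⊖-identityʳ (lookup (axes (suc M) b) j)))
      (Vecₚ.tabulate∘lookup (axes (suc M) b)))

simplex-affineIndependent : ∀ {D} M (b : Vec ℤ D) → AffineIndependent (simplex (suc M) b)
simplex-affineIndependent M b = affineIndependent 𝟘 (axes (suc M) b) λ e eq →
  axes-independent M b e
    (trans (cong (lincombℤ e) (sym (trans (Vecₚ.map-cong ⊖-identityʳ _) (Vecₚ.map-id _)))) eq)

lincomb-simplex : ∀ {D} M (b : Vec ℤ D) c₀ t c →
  lincomb (c₀ ∷ t ∷ c) (simplex M b) ≡ + t ℤ.* + M ∷ (+ t · b ⊕ ι c)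
lincomb-simplex M b c₀ t c = begin
  + c₀ · 𝟘 ⊕ lincomb (t ∷ c) (axes M b)
    ≡⟨ cong₂ _⊕_ (·-zeroʳ (+ c₀)) (lincomb≡lincombℤ (t ∷ c) (axes M b)) ⟩
  𝟘 ⊕ lincombℤ (+ t ∷ ι c) (axes M b) ≡⟨ ⊕-identityˡ _ ⟩
  lincombℤ (+ t ∷ ι c) (axes M b) ≡⟨ lincombℤ-axes M b (+ t) (ι c) ⟩
  + t ℤ.* + M ∷ (+ t · b ⊕ ι c) ∎
  where open ≡-Reasoning

-- Coordinates forced by the slopes -1, 1 and 0

data Kind : Set where
  neg pos nil : Kind

-- `slope` is an entry of b, and `value` the matching coordinate of a nonzero box point: the ceiling
-- of slope · t / N, which is the same for all 0 < t < N.
slope value : Kind → ℤ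
slope neg = ℤ.- + 1
slope pos = + 1
slope nil = + 0
value neg = + 0
value pos = + 1
value nil = + 0

-- N times the fractional part of −slope · t / N, for 0 < t < N.
weight : ℕ → ℕ → Kind → ℕ
weight N t neg = t
weight N t pos = N ∸ t
weight N t nil = 0

weight-< : ∀ {N t} → 0 < t → t < N → ∀ κ → weight N t κ < N
weight-< t>0 t<N neg = t<N
weight-< {suc N} {suc t} t>0 t<N pos = s≤s (ℕₚ.m∸n≤m N t)
weight-< t>0 t<N nil = ℕₚ.<-trans t>0 t<N

pos-∸ : ∀ {m n} → n ≤ m → + (m ∸ n) ≡ + m ℤ.- + n
pos-∸ {m} {n} n≤m = sym (trans (ℤₚ.m-n≡m⊖n m n) (ℤₚ.⊖-≥ n≤m))

weight-solves : ∀ {N t} → t ≤ N → ∀ κ → + N ℤ.* value κ ≡ + t ℤ.* slope κ ℤ.+ + weight N t κ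
weight-solves {N} {t} t≤N neg = identity (+ N) (+ t)
  where
  identity : ∀ N t → N ℤ.* + 0 ≡ t ℤ.* ℤ.- + 1 ℤ.+ t
  identity = ℤSolver.solve-∀
weight-solves {N} {t} t≤N pos =
  trans (identity (+ N) (+ t)) (cong (ℤ._+_ (+ t ℤ.* + 1)) (sym (pos-∸ t≤N)))
  where
  identity : ∀ N t → N ℤ.* + 1 ≡ t ℤ.* + 1 ℤ.+ (N ℤ.- t)
  identity = ℤSolver.solve-∀
weight-solves {N} {t} t≤N nil = identity (+ N) (+ t)
  where
  identity : ∀ N t → N ℤ.* + 0 ≡ t ℤ.* + 0 ℤ.+ + 0
  identity = ℤSolver.solve-∀

-- Uniqueness of remainders modulo `N`: x > 0 would give c ≥ N, and x < 0 would give t ≥ N.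
remainder-unique : ∀ {N t c} x → t < N → c < N → + N ℤ.* x ℤ.+ + t ≡ + c → x ≡ + 0 × c ≡ t
remainder-unique {N} {t} {c} (+ zero) _ _ eq = refl ,
  ℤₚ.+-injective (trans (sym eq) (trans (cong (ℤ._+ + t) (ℤₚ.*-zeroʳ (+ N))) (ℤₚ.+-identityˡ (+ t))))
remainder-unique {N} {t} {c} (+ suc n) _ c<N eq = ⊥-elim (ℕₚ.<⇒≱ c<N (begin
  N ≤⟨ ℕₚ.m≤m*n N (suc n) ⟩
  N * suc n ≤⟨ ℕₚ.m≤m+n _ t ⟩
  N * suc n + t
    ≡⟨ ℤₚ.+-injective (trans (trans (ℤₚ.pos-+ _ t) (cong (ℤ._+ + t) (ℤₚ.pos-* N (suc n)))) eq) ⟩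
  c ∎))
  where open ℕₚ.≤-Reasoning
remainder-unique {N} {t} {c} x@(-[1+ n ]) t<N _ eq = ⊥-elim (ℕₚ.<⇒≱ t<N (begin
  N ≤⟨ ℕₚ.m≤m*n N (suc n) ⟩
  N * suc n ≤⟨ ℕₚ.m≤n+m _ c ⟩
  c + N * suc n ≡⟨ ℤₚ.+-injective (trans (ℤₚ.pos-+ c _)
    (trans (cong₂ ℤ._+_ (sym eq) (ℤₚ.pos-* N (suc n))) (identity (+ N) x (+ t)))) ⟩
  t ∎))
  where
  open ℕₚ.≤-Reasoning
  identity : ∀ N x t → N ℤ.* x ℤ.+ t ℤ.+ N ℤ.* (ℤ.- x) ≡ t
  identity = ℤSolver.solve-∀

-- Moving the slope term to the other side leaves `remainder-unique`. For `pos` the quotient is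
-- shifted by 1, because -t has remainder N - t.
weight-unique : ∀ {N t c} κ x → 0 < t → t < N → c < N →
  + N ℤ.* x ≡ + t ℤ.* slope κ ℤ.+ + c → x ≡ value κ × c ≡ weight N t κ
weight-unique {N} {t} {c} neg x t>0 t<N c<N eq = remainder-unique x t<N c<N
  (trans (cong (ℤ._+ + t) eq) (identity (+ t) (+ c)))
  where
  identity : ∀ t c → t ℤ.* ℤ.- + 1 ℤ.+ c ℤ.+ t ≡ c
  identity = ℤSolver.solve-∀
weight-unique {N} {t} {c} pos x t>0 t<N c<N eq =
  let (x-1≡0 , c≡) = remainder-unique (x ℤ.- + 1) (weight-< t>0 t<N pos) c<N (begin
        + N ℤ.* (x ℤ.- + 1) ℤ.+ + (N ∸ t)
          ≡⟨ cong (ℤ._+_ (+ N ℤ.* (x ℤ.- + 1))) (pos-∸ (ℕₚ.<⇒≤ t<N)) ⟩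
        + N ℤ.* (x ℤ.- + 1) ℤ.+ (+ N ℤ.- + t) ≡⟨ regroup (+ N) x (+ t) ⟩
        + N ℤ.* x ℤ.- + t ≡⟨ cong (ℤ._- + t) eq ⟩
        + t ℤ.* + 1 ℤ.+ + c ℤ.- + t ≡⟨ cancel (+ t) (+ c) ⟩
        + c ∎)
  in trans (restore x) (cong (ℤ._+ + 1) x-1≡0) , c≡
  where
  open ≡-Reasoning
  regroup : ∀ N x t → N ℤ.* (x ℤ.- + 1) ℤ.+ (N ℤ.- t) ≡ N ℤ.* x ℤ.- t
  regroup = ℤSolver.solve-∀
  cancel : ∀ t c → t ℤ.* + 1 ℤ.+ c ℤ.- t ≡ c
  cancel = ℤSolver.solve-∀
  restore : ∀ x → x ≡ x ℤ.- + 1 ℤ.+ + 1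
  restore = ℤSolver.solve-∀
weight-unique {N} {t} {c} nil x t>0 t<N c<N eq =
  remainder-unique x (ℕₚ.<-trans t>0 t<N) c<N (trans (cong (ℤ._+ + 0) eq) (identity (+ t) (+ c)))
  where
  identity : ∀ t c → t ℤ.* + 0 ℤ.+ c ℤ.+ + 0 ≡ c
  identity = ℤSolver.solve-∀

weights-solve : ∀ {D N t} → t ≤ N → (κs : Vec Kind D) →
  + N · map value κs ≡ + t · map slope κs ⊕ ι (map (weight N t) κs)
weights-solve t≤N [] = refl
weights-solve t≤N (κ ∷ κs) = cong₂ _∷_ (weight-solves t≤N κ) (weights-solve t≤N κs)

weights-unique : ∀ {D N t} (κs : Vec Kind D) c x → 0 < t → t < N → (∀ i → lookup c i < N) →
  + N · x ≡ + t · map slope κs ⊕ ι c → x ≡ map value κs × c ≡ map (weight N t) κs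
weights-unique [] [] [] t>0 t<N small eq = refl , refl
weights-unique (κ ∷ κs) (c ∷ cs) (x ∷ xs) t>0 t<N small eq =
  let (x≡ , c≡) = weight-unique κ x t>0 t<N (small zero) (Vecₚ.∷-injectiveˡ eq)
      (xs≡ , cs≡) = weights-unique κs cs xs t>0 t<N (small ∘ suc) (Vecₚ.∷-injectiveʳ eq)
  in cong₂ _∷_ x≡ xs≡ , cong₂ _∷_ c≡ cs≡

remainders-unique : ∀ {D N} (c : Vec ℕ D) x → (∀ i → lookup c i < N) → + N · x ≡ ι c →
  x ≡ 𝟘 × c ≡ replicate D 0
remainders-unique [] [] small eq = refl , refl
remainders-unique (c ∷ cs) (x ∷ xs) small eq =
  let (x≡ , c≡) = remainder-unique x (ℕₚ.≤-<-trans z≤n (small zero)) (small zero)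
        (trans (ℤₚ.+-identityʳ _) (Vecₚ.∷-injectiveˡ eq))
      (xs≡ , cs≡) = remainders-unique cs xs (small ∘ suc) (Vecₚ.∷-injectiveʳ eq)
  in cong₂ _∷_ x≡ xs≡ , cong₂ _∷_ c≡ cs≡

-- The first argument is d − k − ℓ − 1, one less than the number m of the header.
kinds : ∀ m k e → Vec Kind ((m + k) + (k + e))
kinds m k e = replicate (m + k) neg ++ (replicate k pos ++ replicate e nil)

sum-map-replicate : {A : Set} (f : A → ℕ) (x : A) (n : ℕ) → sum (map f (replicate n x)) ≡ n * f x
sum-map-replicate f x zero = refl
sum-map-replicate f x (suc n) = cong (_+_ (f x)) (sum-map-replicate f x n)

sum-map-++ : {A : Set} (f : A → ℕ) {m n : ℕ} (xs : Vec A m) (ys : Vec A n) →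
  sum (map f (xs ++ ys)) ≡ sum (map f xs) + sum (map f ys)
sum-map-++ f xs ys = trans (cong sum (Vecₚ.map-++ f xs ys)) (Vecₚ.sum-++ (map f xs))

-- The `k` weights of kind `pos`, paired with `k` of kind `neg`, contribute k N. The other `m` of
-- kind `neg` and the coordinate `t` of (M, b) give the multiple of `t`.
sum-weights : ∀ m k e {N t} → t ≤ N →
  t + sum (map (weight N t) (kinds m k e)) ≡ suc m * t + k * N
sum-weights m k e {N} {t} t≤N = begin
  t + sum (map (weight N t) (kinds m k e))
    ≡⟨ cong (_+_ t) (trans (sum-map-++ (weight N t) (replicate (m + k) neg) _)
         (cong₂ _+_ (sum-map-replicate (weight N t) neg (m + k))
           (trans (sum-map-++ (weight N t) (replicate k pos) _)
             (cong₂ _+_ (sum-map-replicate (weight N t) pos k) (sum-map-replicate (weight N t) nil e))))) ⟩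
  t + ((m + k) * t + (k * (N ∸ t) + e * 0)) ≡⟨ identity m k e t (N ∸ t) ⟩
  suc m * t + k * (N ∸ t + t) ≡⟨ cong (λ z → suc m * t + k * z) (ℕₚ.m∸n+n≡m t≤N) ⟩
  suc m * t + k * N ∎
  where
  open ≡-Reasoning
  identity : ∀ m k e t u → t + ((m + k) * t + (k * u + e * 0)) ≡ (1 + m) * t + k * (u + t)
  identity = ℕSolver.solve-∀

-- For 0 < y < 1 + a m the ceiling of m y / (1 + a m) is the ceiling of y / a.
height-solve : ∀ m k a {N t c₀ j y} → 0 < t → t < N → c₀ < N →
  c₀ + (suc m * t + k * N) ≡ N * j → N * y ≡ t * suc (a * suc m) →
  Σ ℕ λ q → Σ ℕ λ r → q < suc m × r < a × j ≡ suc (k + q) × y ≡ suc (q * a + r)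
height-solve m′ k a {N} {t} {c₀} {j} {y} t>0 t<N c₀<N sum-eq y-eq =
  q , r , q<m , r<a , j≡ , y≡
  where
  open ℕₚ.≤-Reasoning
  m = suc m′
  M = suc (a * m)
  instance
    N≢0 : ℕ.NonZero N
    N≢0 = ℕ.>-nonZero (ℕₚ.≤-<-trans z≤n t<N)
  k<j : k < j
  k<j = ℕₚ.*-cancelˡ-< N k j (begin-strict
    N * k ≡⟨ ℕₚ.*-comm N k ⟩
    k * N <⟨ ℕₚ.m<n+m (k * N) (ℕₚ.<-≤-trans t>0 (ℕₚ.m≤m+n t (m′ * t))) ⟩
    m * t + k * N ≤⟨ ℕₚ.m≤n+m _ c₀ ⟩
    c₀ + (m * t + k * N) ≡⟨ sum-eq ⟩
    N * j ∎)
  q : ℕ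
  q = j ∸ suc k
  j≡ : j ≡ suc (k + q)
  j≡ = sym (ℕₚ.m+[n∸m]≡n k<j)
  -- As 0 ≤ c₀ < N, this makes q + 1 the ceiling of m t / N.
  reduced : c₀ + m * t ≡ N * suc q
  reduced = ℕₚ.+-cancelʳ-≡ (k * N) _ _ (begin-equality
    c₀ + m * t + k * N ≡⟨ ℕₚ.+-assoc c₀ _ _ ⟩
    c₀ + (m * t + k * N) ≡⟨ sum-eq ⟩
    N * j ≡⟨ cong (N *_) j≡ ⟩
    N * suc (k + q) ≡⟨ identity N k q ⟩
    N * suc q + k * N ∎)
    where
    identity : ∀ N k q → N * (1 + (k + q)) ≡ N * (1 + q) + k * N
    identity = ℕSolver.solve-∀
  -- Since t / N = y / M, the quotient m t / N can be replaced by m y / M.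
  scale : m * t * M ≡ N * (m * y)
  scale = begin-equality
    m * t * M ≡⟨ ℕₚ.*-assoc m t M ⟩
    m * (t * M) ≡⟨ cong (m *_) y-eq ⟨
    m * (N * y) ≡⟨ identity m N y ⟩
    N * (m * y) ∎
    where
    identity : ∀ m N y → m * (N * y) ≡ N * (m * y)
    identity = ℕSolver.solve-∀
  -- The ceiling is used as two inequalities, M q < m y ≤ M (q + 1).
  my≤ : m * y ≤ M * suc q
  my≤ = ℕₚ.*-cancelˡ-≤ N (begin
    N * (m * y) ≡⟨ scale ⟨
    m * t * M ≤⟨ ℕₚ.*-monoˡ-≤ M (ℕₚ.m≤n+m (m * t) c₀) ⟩
    (c₀ + m * t) * M ≡⟨ cong (_* M) reduced ⟩
    N * suc q * M ≡⟨ ℕₚ.*-assoc N (suc q) M ⟩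
    N * (suc q * M) ≡⟨ cong (N *_) (ℕₚ.*-comm (suc q) M) ⟩
    N * (M * suc q) ∎)
  Mq< : M * q < m * y
  Mq< = ℕₚ.*-cancelˡ-< N (M * q) (m * y) (begin-strict
    N * (M * q) ≡⟨ cong (N *_) (ℕₚ.*-comm M q) ⟩
    N * (q * M) ≡⟨ ℕₚ.*-assoc N q M ⟨
    N * q * M <⟨ ℕₚ.*-monoˡ-< M (ℕₚ.+-cancelˡ-< N (N * q) (m * t) (begin-strict
      N + N * q ≡⟨ ℕₚ.*-suc N q ⟨
      N * suc q ≡⟨ reduced ⟨
      c₀ + m * t <⟨ ℕₚ.+-monoˡ-< (m * t) c₀<N ⟩
      N + m * t ∎)) ⟩
    m * t * M ≡⟨ scale ⟩
    N * (m * y) ∎)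
  y<M : y < M
  y<M = ℕₚ.*-cancelˡ-< N y M (begin-strict
    N * y ≡⟨ y-eq ⟩
    t * M <⟨ ℕₚ.*-monoˡ-< M t<N ⟩
    N * M ∎)
  q<m : q < m
  q<m = ℕₚ.≰⇒> λ m≤q → ℕₚ.<-asym y<M (ℕₚ.*-cancelˡ-< m M y (begin-strict
    m * M ≡⟨ ℕₚ.*-comm m M ⟩
    M * m ≤⟨ ℕₚ.*-monoʳ-≤ M m≤q ⟩
    M * q <⟨ Mq< ⟩
    m * y ∎))
  qa<y : q * a < y
  qa<y = ℕₚ.*-cancelˡ-< m (q * a) y (begin-strict
    m * (q * a) ≤⟨ ℕₚ.m≤n+m _ q ⟩
    q + m * (q * a) ≡⟨ identity m q a ⟩
    M * q <⟨ Mq< ⟩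
    m * y ∎)
    where
    identity : ∀ m q a → q + m * (q * a) ≡ (1 + a * m) * q
    identity = ℕSolver.solve-∀
  -- Otherwise y ≥ (q + 1) a + 1. Multiplying by m and comparing with M (q + 1) = q + 1 + m (q + 1)
  -- a gives m ≤ q + 1, hence M ≤ y, a contradiction.
  y≤ : y ≤ q * a + a
  y≤ = ℕₚ.≮⇒≥ λ big → ℕₚ.<⇒≱ y<M (begin
    suc (a * m) ≤⟨ s≤s (ℕₚ.*-monoʳ-≤ a (m≤1+q big)) ⟩
    suc (a * suc q) ≡⟨ cong suc (trans (ℕₚ.*-comm a (suc q)) (ℕₚ.+-comm a (q * a))) ⟩
    suc (q * a + a) ≤⟨ big ⟩
    y ∎)
    where
    identityˡ : ∀ m q a → m * (1 + (q * a + a)) ≡ m + m * (q * a + a)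
    identityˡ = ℕSolver.solve-∀
    identityʳ : ∀ m q a → (1 + a * m) * (1 + q) ≡ 1 + q + m * (q * a + a)
    identityʳ = ℕSolver.solve-∀
    m≤1+q : q * a + a < y → m ≤ suc q
    m≤1+q big = ℕₚ.+-cancelʳ-≤ (m * (q * a + a)) m (suc q) (begin
      m + m * (q * a + a) ≡⟨ identityˡ m q a ⟨
      m * suc (q * a + a) ≤⟨ ℕₚ.*-monoʳ-≤ m big ⟩
      m * y ≤⟨ my≤ ⟩
      M * suc q ≡⟨ identityʳ m q a ⟩
      suc q + m * (q * a + a) ∎)
  r : ℕ
  r = y ∸ suc (q * a)
  y≡ : y ≡ suc (q * a + r)
  y≡ = sym (ℕₚ.m+[n∸m]≡n qa<y)
  r<a : r < a
  r<a = ℕₚ.+-cancelˡ-< (q * a) r a (subst (_≤ q * a + a) y≡ y≤)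


-- The box points of the constructed simplex

point : ∀ m k e → ℕ → Vec ℤ (suc ((m + k) + (k + e)))
point m k e y = + y ∷ map value (kinds m k e)

shiftedSimplex : ∀ m k e → ℕ → Vec (Vec ℤ (suc ((m + k) + (k + e)))) (suc (suc ((m + k) + (k + e))))
shiftedSimplex m k e a = simplex (suc (a * suc m)) (map slope (kinds m k e))

FullBox : ∀ {d m} → Vec (Vec ℤ d) m → ℕ → Vec ℤ d → Set
FullBox {m = m} W = Box W m

height-witness : ∀ m k a q r → q < suc m → r < a →
  Σ ℕ λ c₀ → c₀ < suc (a * suc m) × suc (q * a + r) < suc (a * suc m) ×
    c₀ + (suc m * suc (q * a + r) + k * suc (a * suc m)) ≡ suc (a * suc m) * suc (k + q)
-- The witness is c₀ = M (q + 1) - m y with M = 1 + a m and y = q a + r + 1: over the denominator M,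
-- the coordinate at the origin that completes the height to k + q + 1.
height-witness m′ k a q r q<m r<a = m * s + suc q , s≤s c₀≤ , s≤s y≤ , sum-eq
  where
  open ℕₚ.≤-Reasoning
  m = suc m′
  s = a ∸ suc r
  a≡ : s + suc r ≡ a
  a≡ = ℕₚ.m∸n+n≡m r<a
  c₀≤ : m * s + suc q ≤ a * m
  c₀≤ = begin
    m * s + suc q ≤⟨ ℕₚ.+-monoʳ-≤ (m * s) (ℕₚ.≤-trans q<m (ℕₚ.m≤m*n m (suc r))) ⟩
    m * s + m * suc r ≡⟨ ℕₚ.*-distribˡ-+ m s (suc r) ⟨
    m * (s + suc r) ≡⟨ cong (m *_) a≡ ⟩
    m * a ≡⟨ ℕₚ.*-comm m a ⟩
    a * m ∎
  y≤ : suc (q * a + r) ≤ a * m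
  y≤ = begin
    suc (q * a + r) ≡⟨ ℕₚ.+-suc (q * a) r ⟨
    q * a + suc r ≤⟨ ℕₚ.+-monoʳ-≤ (q * a) r<a ⟩
    q * a + a ≡⟨ ℕₚ.+-comm (q * a) a ⟩
    suc q * a ≤⟨ ℕₚ.*-monoˡ-≤ a q<m ⟩
    m * a ≡⟨ ℕₚ.*-comm m a ⟩
    a * m ∎
  -- Writing `a` as s + (r + 1) gives a polynomial identity free of subtraction.
  identity : ∀ m k q r s →
    m * s + (1 + q) + (m * (1 + (q * (s + (1 + r)) + r)) + k * (1 + (s + (1 + r)) * m)) ≡
    (1 + (s + (1 + r)) * m) * (1 + (k + q))
  identity = ℕSolver.solve-∀
  sum-eq : m * s + suc q + (m * suc (q * a + r) + k * suc (a * m)) ≡ suc (a * m) * suc (k + q)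
  sum-eq = subst (λ b → m * s + suc q + (m * suc (q * b + r) + k * suc (b * m)) ≡ suc (b * m) * suc (k + q))
    a≡ (identity m k q r s)

point-box : ∀ m k e a q r → q < suc m → r < a →
  FullBox (shiftedSimplex m k e a) (suc (k + q)) (point m k e (suc (q * a + r)))
point-box m k e a q r q<m r<a
  with c₀ , c₀<M , y<M , sum-eq ← height-witness m k a q r q<m r<a =
  -- With denominator `M`, the vertex (M, b) has coordinate y / M and contributes exactly the first
  -- entry y.
  M , z<s , c₀ ∷ y ∷ ws ,
  trans (cong (_+_ c₀) (sum-weights m k e (ℕₚ.<⇒≤ y<M))) sum-eq ,
  trans (cong₂ _∷_ (ℤₚ.*-comm (+ M) (+ y)) (weights-solve (ℕₚ.<⇒≤ y<M) κs))
    (sym (lincomb-simplex M (map slope κs) c₀ y ws)) ,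
  small
  where
  M = suc (a * suc m)
  y = suc (q * a + r)
  κs = kinds m k e
  ws = map (weight M y) κs
  small : ∀ i → toℕ i < _ → lookup (c₀ ∷ y ∷ ws) i < M
  small zero _ = c₀<M
  small (suc zero) _ = y<M
  small (suc (suc i)) _ =
    subst (_< M) (sym (Vecₚ.lookup-map i (weight M y) κs)) (weight-< z<s y<M (lookup κs i))

origin-box : ∀ {d m} (W : Vec (Vec ℤ d) m) → FullBox W 0 𝟘
origin-box {m = m} W = 1 , z<s , replicate m 0 , sum-zero m ,
  trans (·-identity 𝟘) (sym (lincomb-zero W)) ,
  λ i _ → subst (_< 1) (sym (Vecₚ.lookup-replicate i 0)) z<s

nonneg-multiple : ∀ {N p} z → 0 < N → + N ℤ.* z ≡ + p → Σ ℕ λ y → z ≡ + y × N * y ≡ p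
nonneg-multiple {N} (+ y) _ eq = y , refl , ℤₚ.+-injective (trans (ℤₚ.pos-* N y) eq)
nonneg-multiple {suc N} -[1+ n ] _ ()

-- The case t = 0: the coordinates at the unit vectors are integers in [0, 1), hence 0, and then c₀
-- = N j < N gives j = 0.
box-origin : ∀ {D j N c₀ y} (b : Vec ℤ D) (c : Vec ℕ D) x → 0 < N → sum (c₀ ∷ 0 ∷ c) ≡ N * j → c₀ < N →
  (∀ i → lookup c i < N) → N * y ≡ 0 → + N · x ≡ + 0 · b ⊕ ι c →
  j ≡ 0 × + y ∷ x ≡ 𝟘 {suc D}
box-origin {D} {j} {N} {c₀} {y} b c x N>0 s c₀<N small y-eq comb =
  j≡0 , cong₂ (λ y x → + y ∷ x) y≡0 (proj₁ zeros)
  where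
  instance
    N≢0 : ℕ.NonZero N
    N≢0 = ℕ.>-nonZero N>0
  zeros : x ≡ 𝟘 × c ≡ replicate D 0
  zeros = remainders-unique c x small
    (trans comb (trans (cong (_⊕ ι c) (·-zeroˡ b)) (⊕-identityˡ (ι c))))
  y≡0 : y ≡ 0
  y≡0 = ℕₚ.*-cancelˡ-≡ y 0 N (trans y-eq (sym (ℕₚ.*-zeroʳ N)))
  c₀≡ : c₀ ≡ N * j
  c₀≡ = trans (sym (ℕₚ.+-identityʳ c₀))
    (trans (cong (_+_ c₀) (sym (trans (cong sum (proj₂ zeros)) (sum-zero D)))) s)
  j≡0 : j ≡ 0
  j≡0 = ℕₚ.n<1⇒n≡0 (ℕₚ.*-cancelˡ-< N j 1 (subst₂ _<_ c₀≡ (sym (ℕₚ.*-identityʳ N)) c₀<N))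

box-nonorigin : ∀ m k e a {j N c₀ t y} c x → 0 < t → t < N → c₀ < N → (∀ i → lookup c i < N) →
  sum (c₀ ∷ t ∷ c) ≡ N * j → N * y ≡ t * suc (a * suc m) →
  + N · x ≡ + t · map slope (kinds m k e) ⊕ ι c →
  Σ ℕ λ q → Σ ℕ λ r → q < suc m × r < a × j ≡ suc (k + q) × + y ∷ x ≡ point m k e (suc (q * a + r))
box-nonorigin m k e a {c₀ = c₀} {t} c x t>0 t<N c₀<N small s y-eq comb =
  let (x≡ , c≡) = weights-unique (kinds m k e) c x t>0 t<N small comb
      sum-eq = trans (cong (_+_ c₀) (trans (sym (sum-weights m k e (ℕₚ.<⇒≤ t<N)))
                 (cong (λ c → t + sum c) (sym c≡)))) s
      (q , r , q<m , r<a , j≡ , y≡) = height-solve m k a t>0 t<N c₀<N sum-eq y-eq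
  in q , r , q<m , r<a , j≡ , cong₂ (λ y x → + y ∷ x) y≡ x≡

-- The split is on the coefficient `t` at (M, b). The first entry of the point is t M / N, hence a
-- natural number y with y / M = t / N.
box-points : ∀ m k e a j x → FullBox (shiftedSimplex m k e a) j x →
  (j ≡ 0 × x ≡ 𝟘) ⊎
  (Σ ℕ λ q → Σ ℕ λ r → q < suc m × r < a × j ≡ suc (k + q) × x ≡ point m k e (suc (q * a + r)))
box-points m k e a j (z ∷ xs) (N , N>0 , c₀ ∷ t ∷ c , s , comb , small) =
  conclude t c (nonneg-multiple z N>0 (trans (Vecₚ.∷-injectiveˡ comb′) (sym (ℤₚ.pos-* t M))))
    s (small (suc zero) (s<s z<s)) (λ i → small (suc (suc i)) (s<s (s<s (Finₚ.toℕ<n i))))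
    (Vecₚ.∷-injectiveʳ comb′)
  where
  M = suc (a * suc m)
  b = map slope (kinds m k e)
  comb′ : + N · (z ∷ xs) ≡ + t ℤ.* + M ∷ (+ t · b ⊕ ι c)
  comb′ = trans comb (lincomb-simplex M b c₀ t c)
  c₀<N : c₀ < N
  c₀<N = small zero z<s
  conclude : ∀ t c → (Σ ℕ λ y → z ≡ + y × N * y ≡ t * M) → sum (c₀ ∷ t ∷ c) ≡ N * j → t < N →
    (∀ i → lookup c i < N) → + N · xs ≡ + t · b ⊕ ι c →
    (j ≡ 0 × z ∷ xs ≡ 𝟘) ⊎
    (Σ ℕ λ q → Σ ℕ λ r → q < suc m × r < a × j ≡ suc (k + q) ×
      z ∷ xs ≡ point m k e (suc (q * a + r)))
  conclude zero c (y , refl , y-eq) s _ small comb =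
    inj₁ (box-origin b c xs N>0 s c₀<N small y-eq comb)
  conclude (suc t) c (y , refl , y-eq) s t<N small comb =
    inj₂ (box-nonorigin m k e a c xs z<s t<N c₀<N small s y-eq comb)

-- Counting box points by height, and realization

count-< : ∀ a → Count (_< a) a
count-< a = List.upTo a , Uniqueₚ.upTo⁺ a , (λ x → mk⇔ ∈-upTo⁻ ∈-upTo⁺) , Listₚ.length-upTo a

-- Height 0 holds only the origin. At height k + q + 1 the points are indexed by r < a if q ≤ m; all
-- other heights are empty.
count-box : ∀ m k e a j → Σ ℕ λ g → Count (FullBox (shiftedSimplex m k e a) j) g ×
  deltaSeq (suc ((m + k) + (k + e))) k (k + e) a j ≡ + g
count-box m k e a zero = 1 ,
  (𝟘 ∷ [] , [] ∷ [] , (λ x → mk⇔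
    (λ { (here refl) → origin-box _ ; (there ()) })
    (λ b → [ (λ (_ , x≡) → here x≡) , (λ { (_ , _ , _ , _ , () , _) }) ]′ (box-points m k e a 0 x b))) ,
    refl) , refl
count-box m k e a (suc j) with j <? k
... | yes j<k = 0 , count-∅ absent , deltaSeq-low _ k (k + e) a j j<k
  where
  absent : ∀ x → ¬ FullBox (shiftedSimplex m k e a) (suc j) x
  absent x b with box-points m k e a (suc j) x b
  ... | inj₂ (q , _ , _ , _ , refl , _) = ℕₚ.<⇒≱ j<k (ℕₚ.m≤m+n k q)
... | no j≮k with q , refl ← ℕₚ.m≤n⇒∃[o]m+o≡n (ℕₚ.≮⇒≥ j≮k) with q <? suc m
... | yes q<m = a , count-cong points (count-image (λ r → point m k e (suc (q * a + r))) injective (count-< a)) ,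
  -- Here d - ℓ equals m + k + 1, so q ≤ m describes exactly the middle range.
  deltaSeq-middle _ k (k + e) a (k + q) (s≤s (ℕₚ.m≤m+n k q))
    (ℕₚ.≤-trans (subst (suc (k + q) ≤_) (ℕₚ.+-comm k (suc m))
      (subst (_≤ k + suc m) (ℕₚ.+-suc k q) (ℕₚ.+-monoʳ-≤ k q<m)))
      (ℕₚ.≤-reflexive (sym (ℕₚ.m+n∸n≡m (suc (m + k)) (k + e)))))
  where
  injective : ∀ {r r′} → point m k e (suc (q * a + r)) ≡ point m k e (suc (q * a + r′)) → r ≡ r′
  injective eq =
    ℕₚ.+-cancelˡ-≡ (q * a) _ _ (ℕₚ.suc-injective (ℤₚ.+-injective (Vecₚ.∷-injectiveˡ eq)))
  points : ∀ x → (Σ ℕ λ r → x ≡ point m k e (suc (q * a + r)) × r < a) ⇔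
    FullBox (shiftedSimplex m k e a) (suc (k + q)) x
  points x = mk⇔ (λ { (r , refl , r<a) → point-box m k e a q r q<m r<a }) only
    where
    only : FullBox (shiftedSimplex m k e a) (suc (k + q)) x →
      Σ ℕ λ r → x ≡ point m k e (suc (q * a + r)) × r < a
    only b with box-points m k e a (suc (k + q)) x b
    ... | inj₂ (q′ , r , _ , r<a , eq , x≡)
      with refl ← ℕₚ.+-cancelˡ-≡ k q q′ (ℕₚ.suc-injective eq) = r , x≡ , r<a
... | no q≮m = 0 , count-∅ absent ,
  deltaSeq-high _ k (k + e) a (k + q) (s≤s (ℕₚ.m≤m+n k q))
    (ℕₚ.≤-<-trans (ℕₚ.≤-reflexive (ℕₚ.m+n∸n≡m (suc (m + k)) (k + e)))
      (s≤s (ℕₚ.≤-trans (ℕₚ.+-monoˡ-≤ k (ℕₚ.≮⇒≥ q≮m)) (ℕₚ.≤-reflexive (ℕₚ.+-comm q k)))))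
  where
  absent : ∀ x → ¬ FullBox (shiftedSimplex m k e a) (suc (k + q)) x
  absent x b with box-points m k e a (suc (k + q)) x b
  ... | inj₂ (q′ , _ , q′<m , _ , eq , _) =
    q≮m (subst (_< suc m) (sym (ℕₚ.+-cancelˡ-≡ k q q′ (ℕₚ.suc-injective eq))) q′<m)

-- Unpeeling every vertex turns the box counts, which are the prescribed entries, into lattice
-- counts of the dilates with these entries as their (d + 1)-fold difference.
shiftedSimplex-realizes : ∀ m k e a →
  Realizable (suc ((m + k) + (k + e))) (deltaSeq (suc ((m + k) + (k + e))) k (k + e) a)
shiftedSimplex-realizes m k e a
  with i , counts , Δi ← unpeel-iterate (shiftedSimplex m k e a)
    (simplex-affineIndependent (a * suc m) (map slope (kinds m k e))) _ ℕₚ.≤-refl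
    (λ n → proj₁ (proj₂ (count-box m k e a n))) =
  _ , shiftedSimplex m k e a , simplex-fullDim (a * suc m) (map slope (kinds m k e)) , i ,
  (λ n → count-cong (λ x → mk⇔
    (from (inDilate⇔box (shiftedSimplex m k e a) n x))
    (to (inDilate⇔box (shiftedSimplex m k e a) n x))) (counts n)) ,
  λ j → trans (deltaCoeff≡Δ^ _ i j) (trans (Δi j) (sym (proj₂ (proj₂ (count-box m k e a j)))))

k≤l⇒realizable : ∀ d k l a → k + l < d → k ≤ l → Realizable d (deltaSeq d k l a)
k≤l⇒realizable d k l a k+l<d k≤l
  -- The parameters are e = ℓ - k and m = d - 1 - k - ℓ, natural numbers by the two inequalities.
  with e , refl ← ℕₚ.m≤n⇒∃[o]m+o≡n k≤l
  with m , refl ← ℕₚ.m≤n⇒∃[o]m+o≡n k+l<d =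
  subst (λ d → Realizable d (deltaSeq d k (k + e) a)) (identity m k e) (shiftedSimplex-realizes m k e a)
  where
  identity : ∀ m k e → 1 + ((m + k) + (k + e)) ≡ 1 + (k + (k + e)) + m
  identity = ℕSolver.solve-∀

theorem0p1 : (d k l a : ℕ) → 1 ≤ d → k + l < d → 1 ≤ a →
    Realizable d (deltaSeq d k l a) ⇔ (k ≤ l)
theorem0p1 d k l (suc a) _ k+l<d _ =
  mk⇔ (realizable⇒k≤l d k l a k+l<d) (k≤l⇒realizable d k l (suc a) k+l<d)
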